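{- For any two sequences of complex numbers $\{\alpha_n\}_{n\ge1}$ and $\{\beta_n\}_{n\ge1}$ the following two conditions are equivalent: $$\alpha_n=\frac{(-1)^{n+1}}{(n+1)!}\sum_{k_1+2k_2+\cdots+nk_n=n}\frac{(k_1+\cdots+k_n+n)!}{k_1!\cdots k_n!}\beta_1^{k_1}\cdots\beta_n^{k_n}\quad\text{for all } n\ge 1$$ and $$\beta_n=\frac{(-1)^{n+1}}{(n+1)!}\sum_{k_1+2k_2+\cdots+nk_n=n}\frac{(k_1+\cdots+k_n+n)!}{k_1!\cdots k_n!}\alpha_1^{k_1}\cdots\alpha_n^{k_n}\quad\text{for all } n\ge 1.$$
   Context: The sums run over all $n$-tuples $(k_1,\ldots,k_n)$ of nonnegative integers with $k_1+2k_2+\cdots+nk_n=n$. -}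

module Defs where

open import Algebra.Bundles using (CommutativeRing; Semiring)
open import Data.Fin.Base using (toℕ)
open import Data.Integer.Base as ℤ using (-1ℤ)
open import Data.List.Base as List using (List; []; _∷_; [_]; cartesianProductWith; filter; upTo)
open import Data.List.Membership.Propositional using (_∈_)
open import Data.List.Membership.Propositional.Properties
  using (∈-cartesianProductWith⁺; ∈-filter⁺; ∈-filter⁻; ∈-upTo⁺)
import Data.List.Relation.Unary.All as All
open import Data.List.Relation.Unary.AllPairs using ([]; _∷_)
open import Data.List.Relation.Unary.Any using (here)
open import Data.List.Relation.Unary.Unique.Propositional using (Unique)
import Data.List.Relation.Unary.Unique.Propositional.Properties as Unique
open import Data.Nat.Base as ℕ using (ℕ; zero; suc; NonZero; _!)
import Data.Nat.Properties as ℕₚ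
open import Data.Product.Base using (_×_; _,_; proj₁; proj₂; ∃-syntax)
open import Data.Rational.Base as ℚ using (ℚ; 0ℚ; 1ℚ; ½; ∣_∣; _/_; 1/_)
import Data.Rational.Properties as ℚₚ
open import Data.Vec.Base as Vec using (Vec; []; _∷_; lookup)
open import Data.Vec.Properties using (∷-injective)
open import Function.Base using (_∘_)
open import Function.Bundles using (_⇔_; mk⇔)
open import Level using (0ℓ)
open import Relation.Binary.PropositionalEquality as ≡ using (_≡_; refl; sym; cong; subst)
open import Relation.Nullary.Decidable.Core using (dec⇒maybe)
open import Tactic.RingSolver using (solve-∀)
open import Tactic.RingSolver.Core.AlmostCommutativeRing
  using (AlmostCommutativeRing; fromCommutativeRing)

private
  ℚ-acr : AlmostCommutativeRing 0ℓ 0ℓ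
  ℚ-acr = fromCommutativeRing ℚₚ.+-*-commutativeRing (λ p → dec⇒maybe (0ℚ ℚₚ.≟ p))

Cauchy : (ℕ → ℚ) → Set
Cauchy x = ∀ ε → 0ℚ ℚ.< ε →
  ∃[ N ] ∀ m n → N ℕ.≤ m → N ℕ.≤ n → ∣ x m ℚ.- x n ∣ ℚ.< ε

Null : (ℕ → ℚ) → Set
Null z = ∀ ε → 0ℚ ℚ.< ε → ∃[ N ] ∀ n → N ℕ.≤ n → ∣ z n ∣ ℚ.< ε

-- Real numbers: Cauchy sequences of rationals, with equality modulo null
-- sequences.  Cauchy and Null carry their moduli as data (ε ↦ N).
record ℝ : Set where
  constructor mkℝ
  field
    seq    : ℕ → ℚ
    cauchy : Cauchy seq

open ℝ

infix 4 _≈ᴿ_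

record _≈ᴿ_ (x y : ℝ) : Set where
  constructor mk≈
  field
    null : Null (λ n → seq x n ℚ.- seq y n)

open _≈ᴿ_

private
  half-pos : ∀ {ε} → 0ℚ ℚ.< ε → 0ℚ ℚ.< ½ ℚ.* ε
  half-pos {ε} 0<ε = subst (ℚ._< ½ ℚ.* ε) (ℚₚ.*-zeroʳ ½) (ℚₚ.*-monoʳ-<-pos ½ 0<ε)

  half+half : ∀ ε → ½ ℚ.* ε ℚ.+ ½ ℚ.* ε ≡ ε
  half+half ε = ≡.trans (sym (ℚₚ.*-distribʳ-+ ε ½ ½)) (ℚₚ.*-identityˡ ε)

  ∣+∣< : ∀ {a b ε} → ∣ a ∣ ℚ.< ½ ℚ.* ε → ∣ b ∣ ℚ.< ½ ℚ.* ε → ∣ a ℚ.+ b ∣ ℚ.< ε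
  ∣+∣< {a} {b} {ε} a< b< = ℚₚ.≤-<-trans (ℚₚ.∣p+q∣≤∣p∣+∣q∣ a b)
    (subst (∣ a ∣ ℚ.+ ∣ b ∣ ℚ.<_) (half+half ε) (ℚₚ.+-mono-< a< b<))

  -- Unfolding these proofs makes checking very slow, hence opaque.
  opaque
    ∣*∣< : ∀ {B ε} → 0ℚ ℚ.< B → 0ℚ ℚ.< ε →
      ∃[ δ ] 0ℚ ℚ.< δ × (∀ b d → ∣ b ∣ ℚ.< B → ∣ d ∣ ℚ.< δ → ∣ b ℚ.* d ∣ ℚ.< ε)
    ∣*∣< {B} {ε} 0<B 0<ε = δ , 0<δ , bound
      where
      instance
        B-pos : ℚ.Positive B
        B-pos = ℚ.positive 0<B
        B≢0 : ℚ.NonZero B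
        B≢0 = ℚₚ.pos⇒nonZero B
        1/B-pos : ℚ.Positive (1/ B)
        1/B-pos = ℚₚ.1/pos⇒pos B
      δ : ℚ
      δ = 1/ B ℚ.* ε
      0<δ : 0ℚ ℚ.< δ
      0<δ = subst (ℚ._< δ) (ℚₚ.*-zeroʳ (1/ B)) (ℚₚ.*-monoʳ-<-pos (1/ B) 0<ε)
      Bδ≡ε : B ℚ.* δ ≡ ε
      Bδ≡ε = ≡.trans (sym (ℚₚ.*-assoc B (1/ B) ε))
        (≡.trans (cong (ℚ._* ε) (ℚₚ.*-inverseʳ B)) (ℚₚ.*-identityˡ ε))
      bound : ∀ b d → ∣ b ∣ ℚ.< B → ∣ d ∣ ℚ.< δ → ∣ b ℚ.* d ∣ ℚ.< ε
      bound b d b< d< = begin-strict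
        ∣ b ℚ.* d ∣      ≡⟨ ℚₚ.∣p*q∣≡∣p∣*∣q∣ b d ⟩
        ∣ b ∣ ℚ.* ∣ d ∣  ≤⟨ ℚₚ.*-monoʳ-≤-nonNeg ∣ d ∣ {{ℚ.nonNegative (ℚₚ.0≤∣p∣ d)}} (ℚₚ.<⇒≤ b<) ⟩
        B ℚ.* ∣ d ∣      <⟨ ℚₚ.*-monoʳ-<-pos B d< ⟩
        B ℚ.* δ          ≡⟨ Bδ≡ε ⟩
        ε                ∎
        where open ℚₚ.≤-Reasoning

  opaque
    bounded : ∀ {x} → Cauchy x →
      ∃[ B ] 0ℚ ℚ.< B × ∃[ N ] ∀ n → N ℕ.≤ n → ∣ x n ∣ ℚ.< B
    bounded {x} c with N , h ← c 1ℚ (ℚₚ.positive⁻¹ 1ℚ) =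
      B , ℚₚ.≤-<-trans (ℚₚ.0≤∣p∣ (x N)) (x< N ℕₚ.≤-refl) , N , x<
      where
      B : ℚ
      B = 1ℚ ℚ.+ ∣ x N ∣
      split : ∀ a b → a ≡ (a ℚ.+ ℚ.- b) ℚ.+ b
      split = solve-∀ ℚ-acr
      x< : ∀ n → N ℕ.≤ n → ∣ x n ∣ ℚ.< B
      x< n N≤n = ℚₚ.≤-<-trans
        (subst (λ a → ∣ a ∣ ℚ.≤ ∣ x n ℚ.- x N ∣ ℚ.+ ∣ x N ∣) (sym (split (x n) (x N)))
          (ℚₚ.∣p+q∣≤∣p∣+∣q∣ (x n ℚ.- x N) (x N)))
        (ℚₚ.+-mono-<-≤ (h n N N≤n ℕₚ.≤-refl) ℚₚ.≤-refl)

  opaque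
    null-≗ : ∀ {z w} → (∀ n → z n ≡ w n) → Null z → Null w
    null-≗ z≗w nz ε 0<ε with N , h ← nz ε 0<ε =
      N , λ n N≤n → subst (λ a → ∣ a ∣ ℚ.< ε) (z≗w n) (h n N≤n)

    null-0 : Null (λ _ → 0ℚ)
    null-0 ε 0<ε = 0 , λ _ _ → 0<ε

    null-neg : ∀ {z} → Null z → Null (λ n → ℚ.- z n)
    null-neg {z} nz ε 0<ε with N , h ← nz ε 0<ε =
      N , λ n N≤n → subst (ℚ._< ε) (sym (ℚₚ.∣-p∣≡∣p∣ (z n))) (h n N≤n)

    null-+ : ∀ {z w} → Null z → Null w → Null (λ n → z n ℚ.+ w n)
    null-+ nz nw ε 0<ε
      with N , h ← nz (½ ℚ.* ε) (half-pos 0<ε) | M , k ← nw (½ ℚ.* ε) (half-pos 0<ε) =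
      N ℕ.⊔ M , λ n ≤n →
        ∣+∣< (h n (ℕₚ.m⊔n≤o⇒m≤o N M ≤n)) (k n (ℕₚ.m⊔n≤o⇒n≤o N M ≤n))

    null-* : ∀ {x z} → Cauchy x → Null z → Null (λ n → x n ℚ.* z n)
    null-* {x} {z} cx nz ε 0<ε
      with B , 0<B , M , x< ← bounded cx
      with δ , 0<δ , bd ← ∣*∣< 0<B 0<ε
      with N , h ← nz δ 0<δ =
      M ℕ.⊔ N , λ n ≤n →
        bd (x n) (z n) (x< n (ℕₚ.m⊔n≤o⇒m≤o M N ≤n)) (h n (ℕₚ.m⊔n≤o⇒n≤o M N ≤n))

    cauchy-const : ∀ q → Cauchy (λ _ → q)
    cauchy-const q ε 0<ε = 0 , λ _ _ _ _ →
      subst (λ a → ∣ a ∣ ℚ.< ε) (sym (ℚₚ.+-inverseʳ q)) 0<ε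

    cauchy-neg : ∀ {x} → Cauchy x → Cauchy (λ n → ℚ.- x n)
    cauchy-neg {x} cx ε 0<ε with N , h ← cx ε 0<ε = N , λ m n N≤m N≤n →
      subst (ℚ._< ε) (≡.trans (sym (ℚₚ.∣-p∣≡∣p∣ (x m ℚ.- x n))) (cong ∣_∣ (eq (x m) (x n))))
        (h m n N≤m N≤n)
      where
      eq : ∀ a b → ℚ.- (a ℚ.+ ℚ.- b) ≡ ℚ.- a ℚ.+ ℚ.- (ℚ.- b)
      eq = solve-∀ ℚ-acr

    cauchy-+ : ∀ {x y} → Cauchy x → Cauchy y → Cauchy (λ n → x n ℚ.+ y n)
    cauchy-+ {x} {y} cx cy ε 0<ε
      with N , h ← cx (½ ℚ.* ε) (half-pos 0<ε) | M , k ← cy (½ ℚ.* ε) (half-pos 0<ε) =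
      N ℕ.⊔ M , λ m n ≤m ≤n →
        subst (λ a → ∣ a ∣ ℚ.< ε) (eq (x m) (x n) (y m) (y n))
          (∣+∣< (h m n (ℕₚ.m⊔n≤o⇒m≤o N M ≤m) (ℕₚ.m⊔n≤o⇒m≤o N M ≤n))
                (k m n (ℕₚ.m⊔n≤o⇒n≤o N M ≤m) (ℕₚ.m⊔n≤o⇒n≤o N M ≤n)))
      where
      eq : ∀ a b c d → (a ℚ.+ ℚ.- b) ℚ.+ (c ℚ.+ ℚ.- d) ≡ (a ℚ.+ c) ℚ.+ ℚ.- (b ℚ.+ d)
      eq = solve-∀ ℚ-acr

    cauchy-* : ∀ {x y} → Cauchy x → Cauchy y → Cauchy (λ n → x n ℚ.* y n)
    cauchy-* {x} {y} cx cy ε 0<ε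
      with Bx , 0<Bx , Mx , x< ← bounded cx | By , 0<By , My , y< ← bounded cy
      with δx , 0<δx , bdx ← ∣*∣< 0<Bx (half-pos 0<ε) | δy , 0<δy , bdy ← ∣*∣< 0<By (half-pos 0<ε)
      with Ny , k ← cy δx 0<δx | Nx , h ← cx δy 0<δy =
      (Mx ℕ.⊔ My) ℕ.⊔ (Nx ℕ.⊔ Ny) , λ m n ≤m ≤n →
        let M≤m  = ℕₚ.m⊔n≤o⇒m≤o (Mx ℕ.⊔ My) (Nx ℕ.⊔ Ny) ≤m
            M≤n  = ℕₚ.m⊔n≤o⇒m≤o (Mx ℕ.⊔ My) (Nx ℕ.⊔ Ny) ≤n
            N≤m  = ℕₚ.m⊔n≤o⇒n≤o (Mx ℕ.⊔ My) (Nx ℕ.⊔ Ny) ≤m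
            N≤n  = ℕₚ.m⊔n≤o⇒n≤o (Mx ℕ.⊔ My) (Nx ℕ.⊔ Ny) ≤n
        in subst (λ a → ∣ a ∣ ℚ.< ε) (eq (x m) (x n) (y m) (y n))
          (∣+∣<
            (bdx (x m) (y m ℚ.- y n) (x< m (ℕₚ.m⊔n≤o⇒m≤o Mx My M≤m))
              (k m n (ℕₚ.m⊔n≤o⇒n≤o Nx Ny N≤m) (ℕₚ.m⊔n≤o⇒n≤o Nx Ny N≤n)))
            (bdy (y n) (x m ℚ.- x n) (y< n (ℕₚ.m⊔n≤o⇒n≤o Mx My M≤n))
              (h m n (ℕₚ.m⊔n≤o⇒m≤o Nx Ny N≤m) (ℕₚ.m⊔n≤o⇒m≤o Nx Ny N≤n))))
      where
      eq : ∀ a b c d → a ℚ.* (c ℚ.+ ℚ.- d) ℚ.+ d ℚ.* (a ℚ.+ ℚ.- b) ≡ a ℚ.* c ℚ.+ ℚ.- (b ℚ.* d)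
      eq = solve-∀ ℚ-acr

≗⇒≈ : ∀ {x y} → (∀ n → seq x n ≡ seq y n) → x ≈ᴿ y
≗⇒≈ {x} {y} x≗y = mk≈ (null-≗
  (λ n → sym (≡.trans (cong (ℚ._- seq y n) (x≗y n)) (ℚₚ.+-inverseʳ (seq y n)))) null-0)

infixl 6 _+ᴿ_
infixl 7 _*ᴿ_
infix  8 -ᴿ_

_+ᴿ_ _*ᴿ_ : ℝ → ℝ → ℝ
mkℝ x cx +ᴿ mkℝ y cy = mkℝ (λ n → x n ℚ.+ y n) (cauchy-+ {x} {y} cx cy)
mkℝ x cx *ᴿ mkℝ y cy = mkℝ (λ n → x n ℚ.* y n) (cauchy-* {x} {y} cx cy)

-ᴿ_ : ℝ → ℝ
-ᴿ mkℝ x cx = mkℝ (λ n → ℚ.- x n) (cauchy-neg {x} cx)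

fromℚᴿ : ℚ → ℝ
fromℚᴿ q = mkℝ (λ _ → q) (cauchy-const q)

private
  ≈-refl : ∀ {x} → x ≈ᴿ x
  ≈-refl = ≗⇒≈ (λ _ → refl)

  ≈-sym : ∀ {x y} → x ≈ᴿ y → y ≈ᴿ x
  ≈-sym {x} {y} (mk≈ p) = mk≈ (null-≗ (λ n → eq (seq x n) (seq y n)) (null-neg p))
    where
    eq : ∀ a b → ℚ.- (a ℚ.+ ℚ.- b) ≡ b ℚ.+ ℚ.- a
    eq = solve-∀ ℚ-acr

  ≈-trans : ∀ {x y z} → x ≈ᴿ y → y ≈ᴿ z → x ≈ᴿ z
  ≈-trans {x} {y} {z} (mk≈ p) (mk≈ q) =
    mk≈ (null-≗ (λ n → eq (seq x n) (seq y n) (seq z n)) (null-+ p q))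
    where
    eq : ∀ a b c → (a ℚ.+ ℚ.- b) ℚ.+ (b ℚ.+ ℚ.- c) ≡ a ℚ.+ ℚ.- c
    eq = solve-∀ ℚ-acr

  +-congᴿ : ∀ {x y u v} → x ≈ᴿ y → u ≈ᴿ v → x +ᴿ u ≈ᴿ y +ᴿ v
  +-congᴿ {x} {y} {u} {v} (mk≈ p) (mk≈ q) =
    mk≈ (null-≗ (λ n → eq (seq x n) (seq y n) (seq u n) (seq v n)) (null-+ p q))
    where
    eq : ∀ a b c d → (a ℚ.+ ℚ.- b) ℚ.+ (c ℚ.+ ℚ.- d) ≡ (a ℚ.+ c) ℚ.+ ℚ.- (b ℚ.+ d)
    eq = solve-∀ ℚ-acr

  *-congᴿ : ∀ {x y u v} → x ≈ᴿ y → u ≈ᴿ v → x *ᴿ u ≈ᴿ y *ᴿ v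
  *-congᴿ {x} {y} {u} {v} (mk≈ p) (mk≈ q) =
    mk≈ (null-≗ (λ n → eq (seq x n) (seq y n) (seq u n) (seq v n))
      (null-+ (null-* {seq x} (cauchy x) q) (null-* {seq v} (cauchy v) p)))
    where
    eq : ∀ a b c d → a ℚ.* (c ℚ.+ ℚ.- d) ℚ.+ d ℚ.* (a ℚ.+ ℚ.- b) ≡ a ℚ.* c ℚ.+ ℚ.- (b ℚ.* d)
    eq = solve-∀ ℚ-acr

  -‿congᴿ : ∀ {x y} → x ≈ᴿ y → -ᴿ x ≈ᴿ -ᴿ y
  -‿congᴿ {x} {y} (mk≈ p) = mk≈ (null-≗ (λ n → eq (seq x n) (seq y n)) (null-neg p))
    where
    eq : ∀ a b → ℚ.- (a ℚ.+ ℚ.- b) ≡ ℚ.- a ℚ.+ ℚ.- (ℚ.- b)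
    eq = solve-∀ ℚ-acr

ℝ-commutativeRing : CommutativeRing 0ℓ 0ℓ
ℝ-commutativeRing = record
  { Carrier = ℝ
  ; _≈_ = _≈ᴿ_
  ; _+_ = _+ᴿ_
  ; _*_ = _*ᴿ_
  ; -_ = -ᴿ_
  ; 0# = fromℚᴿ 0ℚ
  ; 1# = fromℚᴿ 1ℚ
  ; isCommutativeRing = record
    { isRing = record
      { +-isAbelianGroup = record
        { isGroup = record
          { isMonoid = record
            { isSemigroup = record
              { isMagma = record
                { isEquivalence = record { refl = ≈-refl ; sym = ≈-sym ; trans = ≈-trans }
                ; ∙-cong = +-congᴿ
                }
              ; assoc = λ x y z → ≗⇒≈ (λ n → ℚₚ.+-assoc (seq x n) (seq y n) (seq z n))
              }
            ; identity = (λ x → ≗⇒≈ (λ n → ℚₚ.+-identityˡ (seq x n)))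
                       , (λ x → ≗⇒≈ (λ n → ℚₚ.+-identityʳ (seq x n)))
            }
          ; inverse = (λ x → ≗⇒≈ (λ n → ℚₚ.+-inverseˡ (seq x n)))
                    , (λ x → ≗⇒≈ (λ n → ℚₚ.+-inverseʳ (seq x n)))
          ; ⁻¹-cong = -‿congᴿ
          }
        ; comm = λ x y → ≗⇒≈ (λ n → ℚₚ.+-comm (seq x n) (seq y n))
        }
      ; *-cong = *-congᴿ
      ; *-assoc = λ x y z → ≗⇒≈ (λ n → ℚₚ.*-assoc (seq x n) (seq y n) (seq z n))
      ; *-identity = (λ x → ≗⇒≈ (λ n → ℚₚ.*-identityˡ (seq x n)))
                   , (λ x → ≗⇒≈ (λ n → ℚₚ.*-identityʳ (seq x n)))
      ; distrib = (λ x y z → ≗⇒≈ (λ n → ℚₚ.*-distribˡ-+ (seq x n) (seq y n) (seq z n)))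
                , (λ x y z → ≗⇒≈ (λ n → ℚₚ.*-distribʳ-+ (seq x n) (seq y n) (seq z n)))
      }
    ; *-comm = λ x y → ≗⇒≈ (λ n → ℚₚ.*-comm (seq x n) (seq y n))
    }
  }

infixl 6 _+i_

record ℂ : Set where
  constructor _+i_
  field
    re im : ℝ

open ℂ

infix 4 _≈ᶜ_

record _≈ᶜ_ (z w : ℂ) : Set where
  constructor mk≈ᶜ
  field
    re≈ : re z ≈ᴿ re w
    im≈ : im z ≈ᴿ im w

private
  module R = CommutativeRing ℝ-commutativeRing

infixl 6 _+ᶜ_
infixl 7 _*ᶜ_
infix  8 -ᶜ_

_+ᶜ_ _*ᶜ_ : ℂ → ℂ → ℂ
(a +i b) +ᶜ (c +i d) = (a +ᴿ c) +i (b +ᴿ d)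
(a +i b) *ᶜ (c +i d) = (a *ᴿ c +ᴿ -ᴿ (b *ᴿ d)) +i (a *ᴿ d +ᴿ b *ᴿ c)

-ᶜ_ : ℂ → ℂ
-ᶜ (a +i b) = (-ᴿ a) +i (-ᴿ b)

fromℚ : ℚ → ℂ
fromℚ q = fromℚᴿ q +i fromℚᴿ 0ℚ

private
  *-assoc-re : ∀ a b c d e f →
    (a *ᴿ c +ᴿ -ᴿ (b *ᴿ d)) *ᴿ e +ᴿ -ᴿ ((a *ᴿ d +ᴿ b *ᴿ c) *ᴿ f)
    ≈ᴿ a *ᴿ (c *ᴿ e +ᴿ -ᴿ (d *ᴿ f)) +ᴿ -ᴿ (b *ᴿ (c *ᴿ f +ᴿ d *ᴿ e))
  *-assoc-re a b c d e f = ≗⇒≈ (λ n → eq (seq a n) (seq b n) (seq c n) (seq d n) (seq e n) (seq f n))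
    where
    eq : ∀ a b c d e f →
      (a ℚ.* c ℚ.+ ℚ.- (b ℚ.* d)) ℚ.* e ℚ.+ ℚ.- ((a ℚ.* d ℚ.+ b ℚ.* c) ℚ.* f)
      ≡ a ℚ.* (c ℚ.* e ℚ.+ ℚ.- (d ℚ.* f)) ℚ.+ ℚ.- (b ℚ.* (c ℚ.* f ℚ.+ d ℚ.* e))
    eq = solve-∀ ℚ-acr

  *-assoc-im : ∀ a b c d e f →
    (a *ᴿ c +ᴿ -ᴿ (b *ᴿ d)) *ᴿ f +ᴿ (a *ᴿ d +ᴿ b *ᴿ c) *ᴿ e
    ≈ᴿ a *ᴿ (c *ᴿ f +ᴿ d *ᴿ e) +ᴿ b *ᴿ (c *ᴿ e +ᴿ -ᴿ (d *ᴿ f))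
  *-assoc-im a b c d e f = ≗⇒≈ (λ n → eq (seq a n) (seq b n) (seq c n) (seq d n) (seq e n) (seq f n))
    where
    eq : ∀ a b c d e f →
      (a ℚ.* c ℚ.+ ℚ.- (b ℚ.* d)) ℚ.* f ℚ.+ (a ℚ.* d ℚ.+ b ℚ.* c) ℚ.* e
      ≡ a ℚ.* (c ℚ.* f ℚ.+ d ℚ.* e) ℚ.+ b ℚ.* (c ℚ.* e ℚ.+ ℚ.- (d ℚ.* f))
    eq = solve-∀ ℚ-acr

  *-comm-re : ∀ a b c d → a *ᴿ c +ᴿ -ᴿ (b *ᴿ d) ≈ᴿ c *ᴿ a +ᴿ -ᴿ (d *ᴿ b)
  *-comm-re a b c d = ≗⇒≈ (λ n → eq (seq a n) (seq b n) (seq c n) (seq d n))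
    where
    eq : ∀ a b c d → a ℚ.* c ℚ.+ ℚ.- (b ℚ.* d) ≡ c ℚ.* a ℚ.+ ℚ.- (d ℚ.* b)
    eq = solve-∀ ℚ-acr

  *-comm-im : ∀ a b c d → a *ᴿ d +ᴿ b *ᴿ c ≈ᴿ c *ᴿ b +ᴿ d *ᴿ a
  *-comm-im a b c d = ≗⇒≈ (λ n → eq (seq a n) (seq b n) (seq c n) (seq d n))
    where
    eq : ∀ a b c d → a ℚ.* d ℚ.+ b ℚ.* c ≡ c ℚ.* b ℚ.+ d ℚ.* a
    eq = solve-∀ ℚ-acr

  distribˡ-re : ∀ a b c d e f →
    a *ᴿ (c +ᴿ e) +ᴿ -ᴿ (b *ᴿ (d +ᴿ f))
    ≈ᴿ (a *ᴿ c +ᴿ -ᴿ (b *ᴿ d)) +ᴿ (a *ᴿ e +ᴿ -ᴿ (b *ᴿ f))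
  distribˡ-re a b c d e f = ≗⇒≈ (λ n → eq (seq a n) (seq b n) (seq c n) (seq d n) (seq e n) (seq f n))
    where
    eq : ∀ a b c d e f →
      a ℚ.* (c ℚ.+ e) ℚ.+ ℚ.- (b ℚ.* (d ℚ.+ f))
      ≡ (a ℚ.* c ℚ.+ ℚ.- (b ℚ.* d)) ℚ.+ (a ℚ.* e ℚ.+ ℚ.- (b ℚ.* f))
    eq = solve-∀ ℚ-acr

  distribˡ-im : ∀ a b c d e f →
    a *ᴿ (d +ᴿ f) +ᴿ b *ᴿ (c +ᴿ e) ≈ᴿ (a *ᴿ d +ᴿ b *ᴿ c) +ᴿ (a *ᴿ f +ᴿ b *ᴿ e)
  distribˡ-im a b c d e f = ≗⇒≈ (λ n → eq (seq a n) (seq b n) (seq c n) (seq d n) (seq e n) (seq f n))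
    where
    eq : ∀ a b c d e f →
      a ℚ.* (d ℚ.+ f) ℚ.+ b ℚ.* (c ℚ.+ e) ≡ (a ℚ.* d ℚ.+ b ℚ.* c) ℚ.+ (a ℚ.* f ℚ.+ b ℚ.* e)
    eq = solve-∀ ℚ-acr

  identityˡ-re : ∀ a b → R.1# *ᴿ a +ᴿ -ᴿ (R.0# *ᴿ b) ≈ᴿ a
  identityˡ-re a b = ≗⇒≈ (λ n → ≡.trans
    (≡.cong₂ ℚ._+_ (ℚₚ.*-identityˡ (seq a n)) (cong ℚ.-_ (ℚₚ.*-zeroˡ (seq b n))))
    (ℚₚ.+-identityʳ (seq a n)))

  identityˡ-im : ∀ a b → R.1# *ᴿ b +ᴿ R.0# *ᴿ a ≈ᴿ b
  identityˡ-im a b = R.trans (R.+-cong (R.*-identityˡ b) (R.zeroˡ a)) (R.+-identityʳ b)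

  +-congᶜ : ∀ {x y u v} → x ≈ᶜ y → u ≈ᶜ v → x +ᶜ u ≈ᶜ y +ᶜ v
  +-congᶜ (mk≈ᶜ p q) (mk≈ᶜ r s) = mk≈ᶜ (R.+-cong p r) (R.+-cong q s)

  *-congᶜ : ∀ {x y u v} → x ≈ᶜ y → u ≈ᶜ v → x *ᶜ u ≈ᶜ y *ᶜ v
  *-congᶜ (mk≈ᶜ p q) (mk≈ᶜ r s) = mk≈ᶜ
    (R.+-cong (R.*-cong p r) (R.-‿cong (R.*-cong q s)))
    (R.+-cong (R.*-cong p s) (R.*-cong q r))

  ≈ᶜ-trans : ∀ {x y z} → x ≈ᶜ y → y ≈ᶜ z → x ≈ᶜ z
  ≈ᶜ-trans (mk≈ᶜ p q) (mk≈ᶜ r s) = mk≈ᶜ (R.trans p r) (R.trans q s)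

  *-commᶜ : ∀ z w → z *ᶜ w ≈ᶜ w *ᶜ z
  *-commᶜ (a +i b) (c +i d) = mk≈ᶜ (*-comm-re a b c d) (*-comm-im a b c d)

  identityˡᶜ : ∀ z → fromℚ 1ℚ *ᶜ z ≈ᶜ z
  identityˡᶜ (a +i b) = mk≈ᶜ (identityˡ-re a b) (identityˡ-im a b)

  distribˡᶜ : ∀ x y z → x *ᶜ (y +ᶜ z) ≈ᶜ x *ᶜ y +ᶜ x *ᶜ z
  distribˡᶜ (a +i b) (c +i d) (e +i f) =
    mk≈ᶜ (distribˡ-re a b c d e f) (distribˡ-im a b c d e f)

ℂ-commutativeRing : CommutativeRing 0ℓ 0ℓ
ℂ-commutativeRing = record
  { Carrier = ℂ
  ; _≈_ = _≈ᶜ_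
  ; _+_ = _+ᶜ_
  ; _*_ = _*ᶜ_
  ; -_ = -ᶜ_
  ; 0# = fromℚ 0ℚ
  ; 1# = fromℚ 1ℚ
  ; isCommutativeRing = record
    { isRing = record
      { +-isAbelianGroup = record
        { isGroup = record
          { isMonoid = record
            { isSemigroup = record
              { isMagma = record
                { isEquivalence = record
                  { refl = mk≈ᶜ R.refl R.refl
                  ; sym = λ (mk≈ᶜ p q) → mk≈ᶜ (R.sym p) (R.sym q)
                  ; trans = ≈ᶜ-trans
                  }
                ; ∙-cong = +-congᶜ
                }
              ; assoc = λ (a +i b) (c +i d) (e +i f) → mk≈ᶜ (R.+-assoc a c e) (R.+-assoc b d f)
              }
            ; identity = (λ (a +i b) → mk≈ᶜ (R.+-identityˡ a) (R.+-identityˡ b))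
                       , (λ (a +i b) → mk≈ᶜ (R.+-identityʳ a) (R.+-identityʳ b))
            }
          ; inverse = (λ (a +i b) → mk≈ᶜ (R.-‿inverseˡ a) (R.-‿inverseˡ b))
                    , (λ (a +i b) → mk≈ᶜ (R.-‿inverseʳ a) (R.-‿inverseʳ b))
          ; ⁻¹-cong = λ (mk≈ᶜ p q) → mk≈ᶜ (R.-‿cong p) (R.-‿cong q)
          }
        ; comm = λ (a +i b) (c +i d) → mk≈ᶜ (R.+-comm a c) (R.+-comm b d)
        }
      ; *-cong = *-congᶜ
      ; *-assoc = λ (a +i b) (c +i d) (e +i f) →
          mk≈ᶜ (*-assoc-re a b c d e f) (*-assoc-im a b c d e f)
      ; *-identity = identityˡᶜ
                   , (λ z → ≈ᶜ-trans (*-commᶜ z (fromℚ 1ℚ)) (identityˡᶜ z))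
      ; distrib = distribˡᶜ
                , (λ x y z → ≈ᶜ-trans (*-commᶜ (y +ᶜ z) x)
                    (≈ᶜ-trans (distribˡᶜ x y z) (+-congᶜ (*-commᶜ x y) (*-commᶜ x z))))
      }
    ; *-comm = *-commᶜ
    }
  }

-- weightFrom j (k₀ , k₁ , …) = j k₀ + (j + 1) k₁ + ⋯
weightFrom : ∀ {m} → ℕ → Vec ℕ m → ℕ
weightFrom j []       = 0
weightFrom j (k ∷ ks) = j ℕ.* k ℕ.+ weightFrom (suc j) ks

weight : ∀ {m} → Vec ℕ m → ℕ
weight = weightFrom 1

boundedTuples : ∀ m → ℕ → List (Vec ℕ m)
boundedTuples zero    b = [ [] ]
boundedTuples (suc m) b = cartesianProductWith _∷_ (upTo (suc b)) (boundedTuples m b)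

-- The entries of a tuple of weight n are at most n, so searching among the
-- tuples with entries in {0, …, n} misses none: see ∈-tuples and tuples-unique.
tuples : ∀ n → List (Vec ℕ n)
tuples n = filter (λ k → weight k ℕₚ.≟ n) (boundedTuples n n)

private
  ∈-boundedTuples : ∀ {m} j b (k : Vec ℕ m) →
    weightFrom (suc j) k ℕ.≤ b → k ∈ boundedTuples m b
  ∈-boundedTuples j b []       _ = here refl
  ∈-boundedTuples j b (k ∷ ks) w≤b = ∈-cartesianProductWith⁺ _∷_
    (∈-upTo⁺ (ℕ.s≤s (ℕₚ.≤-trans (ℕₚ.m≤n*m k (suc j)) (ℕₚ.m+n≤o⇒m≤o (suc j ℕ.* k) w≤b))))
    (∈-boundedTuples (suc j) b ks (ℕₚ.m+n≤o⇒n≤o (suc j ℕ.* k) w≤b))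

  boundedTuples-unique : ∀ m b → Unique (boundedTuples m b)
  boundedTuples-unique zero    b = All.[] ∷ []
  boundedTuples-unique (suc m) b = Unique.cartesianProductWith⁺ _∷_ ∷-injective
    (Unique.upTo⁺ (suc b)) (boundedTuples-unique m b)

∈-tuples : ∀ {n} (k : Vec ℕ n) → k ∈ tuples n ⇔ weight k ≡ n
∈-tuples {n} k = mk⇔
  (proj₂ ∘ ∈-filter⁻ (λ k → weight k ℕₚ.≟ n) {xs = boundedTuples n n})
  (λ w≡n → ∈-filter⁺ (λ k → weight k ℕₚ.≟ n)
    (∈-boundedTuples 0 n k (ℕₚ.≤-reflexive w≡n)) w≡n)

tuples-unique : ∀ n → Unique (tuples n)
tuples-unique n = Unique.filter⁺ (λ k → weight k ℕₚ.≟ n) (boundedTuples-unique n n)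

private
  module C = CommutativeRing ℂ-commutativeRing

open C public using (_≈_; _+_; _*_; 0#)

open import Algebra.Definitions.RawSemiring (Semiring.rawSemiring C.semiring) public
  using (_^_; product)

∏! : ∀ {m} → Vec ℕ m → ℕ
∏! []       = 1
∏! (k ∷ ks) = k ! ℕ.* ∏! ks

∏!≢0 : ∀ {m} (k : Vec ℕ m) → NonZero (∏! k)
∏!≢0 []       = _
∏!≢0 (k ∷ ks) = ℕₚ.m*n≢0 (k !) (∏! ks) {{k ℕₚ.!≢0}} {{∏!≢0 ks}}

∑ : ∀ {A : Set} → List A → (A → ℂ) → ℂ
∑ xs f = List.foldr (λ x s → f x + s) 0# xs

-- γ₁^k₁ ⋯ γₙ^kₙ; position i : Fin n holds the exponent of γ₍ᵢ₊₁₎.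
monomial : (ℕ → ℂ) → ∀ {n} → Vec ℕ n → ℂ
monomial γ k = product (λ i → γ (suc (toℕ i)) ^ lookup k i)

-- The entry γ 0 never occurs, so γ stands for the sequence (γₙ) with n ≥ 1.
transform : (ℕ → ℂ) → ℕ → ℂ
transform γ n =
  fromℚ (((-1ℤ ℤ.^ suc n) / (suc n !)) {{suc n ℕₚ.!≢0}}) *
  ∑ (tuples n) (λ k →
    fromℚ ((ℤ.+ ((Vec.sum k ℕ.+ n) !) / ∏! k) {{∏!≢0 k}}) * monomial γ k)

{-# OPTIONS --safe #-}

-- Put u = 1 − Σ γₙ xⁿ and v = 1/u.  Integrating divided powers by parts, the tuple sum in the
-- transform satisfies the recurrence that v·(Σ γₙ xⁿ)′ = u·v′ imposes on the coefficients of powers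
-- of v; hence (n + 1) (transform γ)ₙ = (−1)ⁿ⁺¹ [xⁿ] vⁿ⁺¹, which says that x(1 − Σ (transform γ)ₙ xⁿ)
-- is −g(−x) for the compositional inverse g of x·u.  Passing from f to −f⁻¹(−x) is an involution.
--
-- Composition of series is avoided.  For any series z, the numbers Qᶻₛ(n) = [xⁿ] vˢ⁺ⁿ z are the
-- coefficients of a multiple of Gˢ, where g = x·G, and they satisfy Qᶻₛ(n) = Σₖ uₖ Qᶻₛ₊₁₊ₖ(n − k),
-- a recurrence that determines the whole family from Qᶻ₀.  For z₀ = 1 − x v′/v the family starts
-- with 1, so uniqueness gives Qᶻₜ · Qᶻ⁰ₛ = Qᶻₛ₊ₜ, and Qᶻ⁰ₛ is the power Gˢ.  With z = uᵐ⁺¹ z₀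
-- this yields G⁻⁽ᵐ⁺¹⁾ = Qᶻ₀ and [xᵐ] G⁻⁽ᵐ⁺¹⁾ = [xᵐ] u z₀ = (m + 1) uₘ.

module Submission where

import Algebra.Definitions.RawSemiring as RawSemiringDefinitions
import Algebra.Properties.CommutativeMonoid.Mult as CommutativeMult
import Algebra.Properties.CommutativeSemiring.Exp as CommutativeExp
import Algebra.Properties.Ring as RingProperties
import Algebra.Properties.Semiring.Exp as Exp
import Algebra.Properties.Semiring.Mult as Mult
import Algebra.Solver.Ring.NaturalCoefficients.Default as NaturalSolver
open import Algebra.Bundles using (CommutativeRing; Semiring)
open import Data.Bool.Base using (true; false; if_then_else_)
open import Data.Empty using (⊥-elim)
open import Data.Fin.Base as Fin using (Fin; toℕ)
open import Data.Integer.Base as ℤ using (ℤ; -1ℤ)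
import Data.Integer.Properties as ℤₚ
open import Data.List.Base as List using (List; []; _∷_; upTo)
open import Data.Nat.Base as ℕ using (ℕ; zero; suc; NonZero; _!; _≥_)
import Data.Nat.Properties as ℕₚ
import Data.Nat.Solver as ℕSolver
open import Data.Product.Base using (_,_)
import Data.Rational.Base as ℚ
import Data.Rational.Properties as ℚₚ
import Data.Rational.Unnormalised.Base as ℚᵘ
import Data.Rational.Unnormalised.Properties as ℚᵘₚ
open import Data.Vec.Base as Vec using (Vec; []; _∷_; lookup)
open import Function.Base using (_∘_)
open import Function.Bundles using (_⇔_; mk⇔)
open import Level using (_⊔_)
open import Relation.Binary.PropositionalEquality as ≡ using (_≡_)
import Relation.Binary.Reasoning.Setoid as SetoidReasoning
open import Relation.Nullary using (Dec; does; yes; no; ¬_)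
open import Defs using (boundedTuples; tuples; weight; weightFrom)

-- Powers and formal power series over a commutative ring.

module Powers {c ℓ} (R : CommutativeRing c ℓ) where
  open CommutativeRing R
  open Exp semiring using (_^_; ^-congˡ)
  open CommutativeExp commutativeSemiring using (^-distrib-*)

  1^ : ∀ k → 1# ^ k ≈ 1#
  1^ zero    = refl
  1^ (suc k) = trans (*-identityˡ _) (1^ k)

  ^-inverse : ∀ a b k → a * b ≈ 1# → a ^ k * b ^ k ≈ 1#
  ^-inverse a b k p = trans (sym (^-distrib-* a b k)) (trans (^-congˡ k p) (1^ k))

module Series {c ℓ} (R : CommutativeRing c ℓ) where
  open CommutativeRing R
  open Mult semiring using (_×_; ×-congʳ; ×-assoc-*)
  open NaturalSolver commutativeSemiring using (solve; _:+_; _:*_; _:=_)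
  open SetoidReasoning setoid

  Series : Set c
  Series = ℕ → Carrier

  tail : Series → Series
  tail a n = a (suc n)

  infixl 7 _⋆_ _∗_

  -- (a ⋆ F) n = Σₖ aₖ Fₖ(n − k)
  _⋆_ : Series → (ℕ → Series) → Series
  (a ⋆ F) zero    = a 0 * F 0 0
  (a ⋆ F) (suc n) = a 0 * F 0 (suc n) + (tail a ⋆ λ k → F (suc k)) n

  _∗_ : Series → Series → Series
  a ∗ b = a ⋆ λ _ → b

  ⋆-cong : ∀ {a b F G} → (∀ n → a n ≈ b n) → ∀ n →
    (∀ k j → k ℕ.+ j ≡ n → F k j ≈ G k j) → (a ⋆ F) n ≈ (b ⋆ G) n
  ⋆-cong p zero    q = *-cong (p 0) (q 0 0 ≡.refl)
  ⋆-cong p (suc n) q = +-cong (*-cong (p 0) (q 0 (suc n) ≡.refl))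
    (⋆-cong (p ∘ suc) n (λ k j e → q (suc k) j (≡.cong suc e)))

  *-nullˡ : ∀ {x} y → x ≈ 0# → x * y ≈ 0#
  *-nullˡ y p = trans (*-congʳ p) (zeroˡ y)

  ×-zeroʳ : ∀ n → n × 0# ≈ 0#
  ×-zeroʳ n = trans (sym (×-congʳ n (zeroˡ 0#))) (trans (sym (×-assoc-* n 0# 0#)) (zeroʳ _))

  -- With `a 0` zero, the members of `F` and `G` at index 0 drop out, so only degrees below `n` are
  -- compared. This makes strong induction on the degree possible.
  ⋆-cong-positive : ∀ {a F G} → a 0 ≈ 0# → ∀ n →
    (∀ k j → suc k ℕ.+ j ≡ n → F (suc k) j ≈ G (suc k) j) → (a ⋆ F) n ≈ (a ⋆ G) n
  ⋆-cong-positive a₀≈0 zero    q = trans (*-nullˡ _ a₀≈0) (sym (*-nullˡ _ a₀≈0))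
  ⋆-cong-positive a₀≈0 (suc n) q = +-cong (trans (*-nullˡ _ a₀≈0) (sym (*-nullˡ _ a₀≈0)))
    (⋆-cong (λ _ → refl) n (λ k j e → q k j (≡.cong suc e)))

  -- Peels off the last term, whereas the definition peels off the first; `∗-comm` plays the two
  -- against each other.
  ∗-suc : ∀ a b n → (a ∗ b) (suc n) ≈ (a ∗ tail b) n + a (suc n) * b 0
  ∗-suc a b zero    = refl
  ∗-suc a b (suc n) = trans (+-congˡ (∗-suc (tail a) b n)) (sym (+-assoc _ _ _))

  ∗-comm : ∀ a b n → (a ∗ b) n ≈ (b ∗ a) n
  ∗-comm a b zero    = *-comm _ _
  ∗-comm a b (suc n) = begin
    a 0 * b (suc n) + (tail a ∗ b) n ≈⟨ +-cong (*-comm _ _) (∗-comm (tail a) b n) ⟩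
    b (suc n) * a 0 + (b ∗ tail a) n ≈⟨ +-comm _ _ ⟩
    (b ∗ tail a) n + b (suc n) * a 0 ≈⟨ ∗-suc b a n ⟨
    (b ∗ a) (suc n) ∎

  ∗-distribˡ : ∀ a b d n → (a ∗ λ k → b k + d k) n ≈ (a ∗ b) n + (a ∗ d) n
  ∗-distribˡ a b d zero    = distribˡ _ _ _
  ∗-distribˡ a b d (suc n) = trans (+-congˡ (∗-distribˡ (tail a) b d n))
    (solve 5 (λ x y z a b → x :* (y :+ z) :+ (a :+ b) := (x :* y :+ a) :+ (x :* z :+ b)) refl _ _ _ _ _)

  ∗-scale : ∀ a x b n → (a ∗ λ k → x * b k) n ≈ x * (a ∗ b) n
  ∗-scale a x b zero    = solve 3 (λ x y z → x :* (y :* z) := y :* (x :* z)) refl _ _ _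
  ∗-scale a x b (suc n) = trans (+-congˡ (∗-scale (tail a) x b n))
    (solve 4 (λ x y z a → x :* (y :* z) :+ y :* a := y :* (x :* z :+ a)) refl _ _ _ _)

  -- Multiplication by `a` is linear and acts on each `F k` separately. A constant family gives
  -- associativity; a general one allows a whole recurrence to be multiplied by a series.
  ∗-⋆ : ∀ a u F n → (a ∗ (u ⋆ F)) n ≈ (u ⋆ λ k → a ∗ F k) n
  ∗-⋆ a u F zero    = solve 3 (λ x y z → x :* (y :* z) := y :* (x :* z)) refl _ _ _
  ∗-⋆ a u F (suc n) = begin
    (a ∗ (u ⋆ F)) (suc n)
      ≈⟨ ∗-suc a (u ⋆ F) n ⟩
    (a ∗ λ k → u 0 * F 0 (suc k) + (tail u ⋆ F ∘ suc) k) n + a (suc n) * (u 0 * F 0 0)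
      ≈⟨ +-congʳ (∗-distribˡ a (λ k → u 0 * F 0 (suc k)) (tail u ⋆ F ∘ suc) n) ⟩
    ((a ∗ λ k → u 0 * F 0 (suc k)) n + (a ∗ (tail u ⋆ F ∘ suc)) n) + a (suc n) * (u 0 * F 0 0)
      ≈⟨ +-congʳ (+-cong (∗-scale a (u 0) (tail (F 0)) n) (∗-⋆ a (tail u) (F ∘ suc) n)) ⟩
    (u 0 * (a ∗ tail (F 0)) n + (tail u ⋆ λ k → a ∗ F (suc k)) n) + a (suc n) * (u 0 * F 0 0)
      ≈⟨ solve 5 (λ x y a b p → (a :* x :+ y) :+ b :* (a :* p) := a :* (x :+ b :* p) :+ y) refl _ _ _ _ _ ⟩
    u 0 * ((a ∗ tail (F 0)) n + a (suc n) * F 0 0) + (tail u ⋆ λ k → a ∗ F (suc k)) n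
      ≈⟨ +-congʳ (*-congˡ (∗-suc a (F 0) n)) ⟨
    (u ⋆ λ k → a ∗ F k) (suc n) ∎

  ∗-cong : ∀ {a b d e} → (∀ n → a n ≈ b n) → (∀ n → d n ≈ e n) → ∀ n → (a ∗ d) n ≈ (b ∗ e) n
  ∗-cong p q n = ⋆-cong p n (λ _ j _ → q j)

  ∗-assoc : ∀ a b d n → ((a ∗ b) ∗ d) n ≈ (a ∗ (b ∗ d)) n
  ∗-assoc a b d n = begin
    ((a ∗ b) ∗ d) n ≈⟨ ∗-comm (a ∗ b) d n ⟩
    (d ∗ (a ∗ b)) n ≈⟨ ∗-⋆ d a (λ _ → b) n ⟩
    (a ∗ (d ∗ b)) n ≈⟨ ∗-cong (λ _ → refl) (∗-comm d b) n ⟩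
    (a ∗ (b ∗ d)) n ∎

  0s 1s : Series
  0s _ = 0#
  1s zero    = 1#
  1s (suc _) = 0#

  ∗-zeroˡ : ∀ b n → (0s ∗ b) n ≈ 0#
  ∗-zeroˡ b zero    = zeroˡ _
  ∗-zeroˡ b (suc n) = trans (+-cong (zeroˡ _) (∗-zeroˡ b n)) (+-identityˡ _)

  ∗-identityˡ : ∀ b n → (1s ∗ b) n ≈ b n
  ∗-identityˡ b zero    = *-identityˡ _
  ∗-identityˡ b (suc n) =
    trans (+-cong (*-identityˡ _) (∗-zeroˡ b n)) (+-identityʳ _)

  TorsionFree : Set (c ⊔ ℓ)
  TorsionFree = ∀ n {x y} → suc n × x ≈ suc n × y → x ≈ y

  ZeroConstant : Series → Set ℓ
  ZeroConstant a = a 0 ≈ 0#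

  Geometric : Series → Series → Set ℓ
  Geometric a v = ∀ n → v n ≈ 1s n + (a ∗ v) n

  record ReciprocalFactorials (inv! : Series) : Set ℓ where
    field
      inv!-zero : inv! 0 ≈ 1#
      inv!-suc  : ∀ n → suc n × inv! (suc n) ≈ inv! n

  seriesRing : CommutativeRing c ℓ
  seriesRing = record
    { Carrier = Series
    ; _≈_ = λ a b → ∀ n → a n ≈ b n
    ; _+_ = λ a b n → a n + b n
    ; _*_ = _∗_
    ; -_ = λ a n → - a n
    ; 0# = 0s
    ; 1# = 1s
    ; isCommutativeRing = record
      { isRing = record
        { +-isAbelianGroup = record
          { isGroup = record
            { isMonoid = record
              { isSemigroup = record
                { isMagma = record
                  { isEquivalence = record
                    { refl = λ _ → refl
                    ; sym = λ p n → sym (p n)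
                    ; trans = λ p q n → trans (p n) (q n)
                    }
                  ; ∙-cong = λ p q n → +-cong (p n) (q n)
                  }
                ; assoc = λ a b d n → +-assoc (a n) (b n) (d n)
                }
              ; identity = (λ a n → +-identityˡ (a n)) , (λ a n → +-identityʳ (a n))
              }
            ; inverse = (λ a n → -‿inverseˡ (a n)) , (λ a n → -‿inverseʳ (a n))
            ; ⁻¹-cong = λ p n → -‿cong (p n)
            }
          ; comm = λ a b n → +-comm (a n) (b n)
          }
        ; *-cong = ∗-cong
        ; *-assoc = ∗-assoc
        ; *-identity = ∗-identityˡ , (λ a n → trans (∗-comm a 1s n) (∗-identityˡ a n))
        ; distrib = ∗-distribˡ , (λ a b d n → begin
            ((λ k → b k + d k) ∗ a) n ≈⟨ ∗-comm (λ k → b k + d k) a n ⟩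
            (a ∗ λ k → b k + d k) n   ≈⟨ ∗-distribˡ a b d n ⟩
            (a ∗ b) n + (a ∗ d) n     ≈⟨ +-cong (∗-comm a b n) (∗-comm a d n) ⟩
            (b ∗ a) n + (d ∗ a) n     ∎)
        }
      ; *-comm = ∗-comm
      }
    }

-- The Euler derivation and powers of 1/(1 - C).

module Derivation {c ℓ} (R : CommutativeRing c ℓ) where
  open CommutativeRing R
  open Mult semiring using (_×_; ×-congʳ; ×-homo-+; ×-assocˡ; ×-comm-*)
  open CommutativeMult +-commutativeMonoid using (×-distrib-+)
  open Series R
  module S = CommutativeRing seriesRing
  open Exp S.semiring public using (_^_)
  module SM = Mult S.semiring
  open NaturalSolver commutativeSemiring using (solve; _:+_; _:=_)
  open SetoidReasoning setoid

  -- The Euler operator x·d/dx, which preserves degrees and so avoids the index shift of the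
  -- derivative.
  D : Series → Series
  D a n = n × a n

  D-cong : ∀ {a b} → a S.≈ b → D a S.≈ D b
  D-cong p n = ×-congʳ n (p n)

  -- Since `suc n × y` unfolds to `y + n × y`, the tail of `D a` is `tail a` plus `D (tail a)`; the
  -- induction on the degree rests on this.
  D-∗ : ∀ a b → D (a ∗ b) S.≈ D a ∗ b S.+ a ∗ D b
  D-∗ a b zero    = sym (trans (+-cong (zeroˡ _) (zeroʳ _)) (+-identityˡ _))
  D-∗ a b (suc n) = begin
    suc n × (a 0 * b (suc n) + (tail a ∗ b) n)
      ≈⟨ ×-distrib-+ _ _ (suc n) ⟩
    suc n × (a 0 * b (suc n)) + ((tail a ∗ b) n + n × (tail a ∗ b) n)
      ≈⟨ +-cong (sym (×-comm-* (suc n) _ _)) (+-congˡ (D-∗ (tail a) b n)) ⟩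
    a 0 * D b (suc n) + ((tail a ∗ b) n + ((D (tail a) ∗ b) n + (tail a ∗ D b) n))
      ≈⟨ regroup _ _ _ _ (b (suc n)) ⟩
    (0# * b (suc n) + ((tail a ∗ b) n + (D (tail a) ∗ b) n)) + (a 0 * D b (suc n) + (tail a ∗ D b) n)
      ≈⟨ +-congʳ (+-congˡ (S.distribʳ b (tail a) (D (tail a)) n)) ⟨
    (D a ∗ b) (suc n) + (a ∗ D b) (suc n) ∎
    where
    arrange : ∀ x y z w → x + (y + (z + w)) ≈ (y + z) + (x + w)
    arrange = solve 4 (λ x y z w → x :+ (y :+ (z :+ w)) := (y :+ z) :+ (x :+ w)) refl
    regroup : ∀ x y z w t → x + (y + (z + w)) ≈ (0# * t + (y + z)) + (x + w)
    regroup x y z w t = trans (arrange x y z w)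
      (+-congʳ (sym (trans (+-congʳ (zeroˡ t)) (+-identityˡ _))))

  D-1s : D 1s S.≈ 0s
  D-1s zero    = refl
  D-1s (suc n) = ×-zeroʳ (suc n)

  ×-coefficient : ∀ r a n → (r SM.× a) n ≈ r × a n
  ×-coefficient zero    a n = refl
  ×-coefficient (suc r) a n = +-congˡ (×-coefficient r a n)

  module GeometricInverse (C v : Series) (v-fix : Geometric C v) where
    private
      module SR = SetoidReasoning S.setoid

    v₀≈1 : C 0 ≈ 0# → v 0 ≈ 1#
    v₀≈1 C₀≈0 = trans (v-fix 0) (trans (+-congˡ (*-nullˡ _ C₀≈0)) (+-identityʳ _))

    u : Series
    u = 1s S.- C

    -- Solves a linear fixed-point equation; applied to `v` itself and to the equation obtained by
    -- differentiating it.
    u∗-fixpoint : ∀ {a b} → a S.≈ b S.+ C ∗ a → u ∗ a S.≈ b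
    u∗-fixpoint {a} {b} p = SR.begin
      u ∗ a                         SR.≈⟨ S.distribʳ a 1s (S.- C) ⟩
      1s ∗ a S.+ (S.- C) ∗ a
        SR.≈⟨ S.+-cong (S.trans (S.*-identityˡ a) p) (S.sym (-‿distribˡ-* C a)) ⟩
      (b S.+ C ∗ a) S.- C ∗ a       SR.≈⟨ S.+-assoc _ _ _ ⟩
      b S.+ (C ∗ a S.- C ∗ a)       SR.≈⟨ S.+-congˡ (S.-‿inverseʳ _) ⟩
      b S.+ 0s                      SR.≈⟨ S.+-identityʳ _ ⟩
      b SR.∎
      where
      open RingProperties S.ring using (-‿distribˡ-*)

    u∗v : u ∗ v S.≈ 1s
    u∗v = u∗-fixpoint v-fix

    v-step : ∀ a → v ∗ a S.≈ a S.+ C ∗ (v ∗ a)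
    v-step a = SR.begin
      v ∗ a                      SR.≈⟨ S.*-congʳ v-fix ⟩
      (1s S.+ C ∗ v) ∗ a         SR.≈⟨ S.distribʳ a 1s (C ∗ v) ⟩
      1s ∗ a S.+ C ∗ v ∗ a       SR.≈⟨ S.+-cong (S.*-identityˡ a) (S.*-assoc C v a) ⟩
      a S.+ C ∗ (v ∗ a)          SR.∎

    -- Differentiating `v-fix` gives `u ∗ D v` equal to `D C ∗ v`; a further factor `v` cancels `u`.
    D-v : D v S.≈ v ∗ v ∗ D C
    D-v = SR.begin
      D v                            SR.≈⟨ S.*-identityʳ _ ⟨
      D v ∗ 1s                       SR.≈⟨ S.*-congˡ u∗v ⟨
      D v ∗ (u ∗ v)                  SR.≈⟨ r₁ _ _ _ ⟩
      u ∗ D v ∗ v                    SR.≈⟨ S.*-congʳ u∗Dv ⟩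
      D C ∗ v ∗ v                    SR.≈⟨ r₂ _ _ ⟩
      v ∗ v ∗ D C                    SR.∎
      where
      open NaturalSolver S.commutativeSemiring using () renaming (solve to solveS; _:*_ to _:∗_; _:=_ to _:≈_)
      r₁ : ∀ a b d → a ∗ (b ∗ d) S.≈ b ∗ a ∗ d
      r₁ = solveS 3 (λ a b d → a :∗ (b :∗ d) :≈ b :∗ a :∗ d) S.refl
      r₂ : ∀ a b → a ∗ b ∗ b S.≈ b ∗ b ∗ a
      r₂ = solveS 2 (λ a b → a :∗ b :∗ b :≈ b :∗ b :∗ a) S.refl
      Dv : D v S.≈ D C ∗ v S.+ C ∗ D v
      Dv n = trans (D-cong v-fix n) (trans (×-distrib-+ _ _ n) (trans (+-cong (D-1s n) (D-∗ C v n)) (+-identityˡ _)))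
      u∗Dv : u ∗ D v S.≈ D C ∗ v
      u∗Dv = u∗-fixpoint Dv

    D-v^ : ∀ r → D (v ^ r) S.≈ r SM.× (v ^ suc r ∗ D C)
    D-v^ zero    = D-1s
    D-v^ (suc r) = SR.begin
      D (v ∗ v ^ r)                                             SR.≈⟨ D-∗ v (v ^ r) ⟩
      D v ∗ v ^ r S.+ v ∗ D (v ^ r)
        SR.≈⟨ S.+-cong (S.*-congʳ D-v) (S.*-congˡ (D-v^ r)) ⟩
      v ∗ v ∗ D C ∗ v ^ r S.+ v ∗ (r SM.× (v ^ suc r ∗ D C))
        SR.≈⟨ S.+-cong (r₁ _ _ _)
          (S.trans (SM.×-comm-* r _ _) (SM.×-congʳ r (S.sym (S.*-assoc _ _ _)))) ⟩
      suc r SM.× (v ^ suc (suc r) ∗ D C)                        SR.∎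
      where
      open NaturalSolver S.commutativeSemiring using () renaming (solve to solveS; _:*_ to _:∗_; _:=_ to _:≈_)
      r₁ : ∀ a d p → a ∗ a ∗ d ∗ p S.≈ a ∗ (a ∗ p) ∗ d
      r₁ = solveS 3 (λ a d p → a :∗ a :∗ d :∗ p :≈ a :∗ (a :∗ p) :∗ d) S.refl

    -- Start from v^(r+1) = v^r + C·v^(r+1). Only the first summand is differentiated, by `D-v^`,
    -- while the second keeps its factor `n`. Both become products with v^(r+1), contributing r·i
    -- and n to the multiplier of `C i`.
    v^-recurrence : ∀ r n →
      n × (v ^ suc r) n ≈ ((λ i → (n ℕ.+ r ℕ.* i) × C i) ∗ v ^ suc r) n
    v^-recurrence r n = begin
      n × (v ^ suc r) n
        ≈⟨ ×-congʳ n (v-step (v ^ r) n) ⟩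
      n × ((v ^ r) n + (C ∗ v ^ suc r) n)
        ≈⟨ ×-distrib-+ _ _ n ⟩
      D (v ^ r) n + n × (C ∗ v ^ suc r) n
        ≈⟨ +-cong (D-v^ r n) (sym (×-coefficient n (C ∗ v ^ suc r) n)) ⟩
      (r SM.× (v ^ suc r ∗ D C) S.+ n SM.× (C ∗ v ^ suc r)) n
        ≈⟨ S.+-cong (S.trans (SM.×-congʳ r (S.*-comm _ _)) (S.sym (SM.×-assoc-* r _ _)))
                    (S.sym (SM.×-assoc-* n _ _)) n ⟩
      ((r SM.× D C) ∗ v ^ suc r S.+ (n SM.× C) ∗ v ^ suc r) n
        ≈⟨ S.distribʳ (v ^ suc r) (r SM.× D C) (n SM.× C) n ⟨
      ((r SM.× D C S.+ n SM.× C) ∗ v ^ suc r) n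
        ≈⟨ ∗-cong {d = v ^ suc r} coefficient (λ _ → refl) n ⟩
      ((λ i → (n ℕ.+ r ℕ.* i) × C i) ∗ v ^ suc r) n ∎
      where
      coefficient : ∀ i → (r SM.× D C S.+ n SM.× C) i ≈ (n ℕ.+ r ℕ.* i) × C i
      coefficient i = begin
        (r SM.× D C) i + (n SM.× C) i ≈⟨ +-cong (×-coefficient r (D C) i) (×-coefficient n C i) ⟩
        r × (i × C i) + n × C i       ≈⟨ +-congʳ (×-assocˡ (C i) r i) ⟩
        (r ℕ.* i) × C i + n × C i     ≈⟨ +-comm _ _ ⟩
        n × C i + (r ℕ.* i) × C i     ≈⟨ ×-homo-+ (C i) n (r ℕ.* i) ⟨
        (n ℕ.+ r ℕ.* i) × C i ∎

-- Lagrange inversion without composition of series.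

module LagrangeInversion {c ℓ} (R : CommutativeRing c ℓ)
  (×-cancelˡ : Series.TorsionFree R) (C v : Series.Series R)
  (C₀≈0 : Series.ZeroConstant R C) (v-fix : Series.Geometric R C v)
  where
  open CommutativeRing R
  open Mult semiring
  open Series R
  open Derivation R
  open GeometricInverse C v v-fix
  open Powers seriesRing using (^-inverse)
  open Exp S.semiring using (^-congˡ; ^-homo-*)
  open CommutativeMult +-commutativeMonoid using (×-distrib-+)
  open RingProperties ring using (-‿distribʳ-*)
  open SetoidReasoning setoid
  private
    module SR = SetoidReasoning S.setoid

  -- A family A·Gˢ satisfies this when G = 1 + G·C(x·G), that is, when g = x·G solves g·(1 - C(g)) =
  -- x. The index `suc s + k` takes the place of the composition.
  Recurrent : (ℕ → Series) → Set ℓ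
  Recurrent F = ∀ s n → F (suc s) n ≈ F s n + (C ⋆ λ k → F (suc s ℕ.+ k)) n

  -- As `C 0` vanishes, the convolution involves only degrees below `n`, though at larger `s`. Hence
  -- the outer induction is on the degree for all `s` at once, and the inner one on `s`.
  recurrent-unique : ∀ {F G} → Recurrent F → Recurrent G → F 0 S.≈ G 0 → ∀ s → F s S.≈ G s
  recurrent-unique {F} {G} F-rec G-rec F₀≈G₀ s n = below (suc n) n ℕₚ.≤-refl s
    where
    below : ∀ m n → n ℕ.< m → ∀ s → F s n ≈ G s n
    below (suc m) n n<m zero    = F₀≈G₀ n
    below (suc m) n n<m (suc s) = begin
      F (suc s) n                               ≈⟨ F-rec s n ⟩
      F s n + (C ⋆ λ k → F (suc s ℕ.+ k)) n
        ≈⟨ +-cong (below (suc m) n n<m s) (⋆-cong-positive C₀≈0 n λ k j e →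
        below m j (ℕₚ.<-≤-trans (ℕ.s≤s (ℕₚ.m≤n+m j k)) (ℕₚ.≤-trans (ℕₚ.≤-reflexive e) (ℕₚ.≤-pred n<m))) _) ⟩
      G s n + (C ⋆ λ k → G (suc s ℕ.+ k)) n     ≈⟨ G-rec s n ⟨
      G (suc s) n                               ∎

  recurrent-∗ : ∀ a {F} → Recurrent F → Recurrent (λ s → a ∗ F s)
  recurrent-∗ a {F} F-rec s n = begin
    (a ∗ F (suc s)) n
      ≈⟨ S.*-congˡ {a} (F-rec s) n ⟩
    (a ∗ λ i → F s i + (C ⋆ λ k → F (suc s ℕ.+ k)) i) n
      ≈⟨ S.distribˡ a (F s) (C ⋆ λ k → F (suc s ℕ.+ k)) n ⟩
    (a ∗ F s) n + (a ∗ (C ⋆ λ k → F (suc s ℕ.+ k))) n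
      ≈⟨ +-congˡ (∗-⋆ a C (λ k → F (suc s ℕ.+ k)) n) ⟩
    (a ∗ F s) n + (C ⋆ λ k → a ∗ F (suc s ℕ.+ k)) n ∎

  recurrent-shift : ∀ t {F} → Recurrent F → Recurrent (λ s → F (s ℕ.+ t))
  recurrent-shift t {F} F-rec s n = trans (F-rec (s ℕ.+ t) n)
    (+-congˡ (⋆-cong (λ _ → refl) n λ k j _ → reflexive (≡.cong (λ i → F (suc i) j)
      (≡.trans (ℕₚ.+-assoc s t k) (≡.trans (≡.cong (s ℕ.+_) (ℕₚ.+-comm t k)) (≡.sym (ℕₚ.+-assoc s k t)))))))

  -- By Lagrange's formula, Q z s n is the coefficient of xⁿ in z(g)·Gˢ·g′·u(g), where x = g·u(g)
  -- and g = x·G.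
  Q : Series → ℕ → Series
  Q z s n = (v ^ (s ℕ.+ n) ∗ z) n

  -- Apply `v-step` at the power `s + n`. In degree j = n - k the power `suc s + n` is
  -- `(suc s + k) + j`, so each term of the product with `C` lies on the diagonal again.
  Q-recurrent : ∀ z → Recurrent (Q z)
  Q-recurrent z s n = begin
    (v ^ suc (s ℕ.+ n) ∗ z) n
      ≈⟨ S.*-congʳ (v-step (v ^ (s ℕ.+ n))) n ⟩
    ((v ^ (s ℕ.+ n) S.+ C ∗ v ^ suc (s ℕ.+ n)) ∗ z) n
      ≈⟨ S.distribʳ z (v ^ (s ℕ.+ n)) _ n ⟩
    Q z s n + (C ∗ v ^ suc (s ℕ.+ n) ∗ z) n
      ≈⟨ +-congˡ (S.*-assoc C (v ^ suc (s ℕ.+ n)) z n) ⟩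
    Q z s n + (C ∗ (v ^ suc (s ℕ.+ n) ∗ z)) n
      ≈⟨ +-congˡ (⋆-cong (λ _ → refl) n λ k j e → reflexive (≡.cong (λ i → (v ^ suc i ∗ z) j)
           (≡.trans (≡.cong (s ℕ.+_) (≡.sym e)) (≡.sym (ℕₚ.+-assoc s k j))))) ⟩
    Q z s n + (C ⋆ λ k → Q z (suc s ℕ.+ k)) n ∎

  -- By `D-v`, the subtracted term is the logarithmic derivative D v / v.
  z₀ : Series
  z₀ = 1s S.- v ∗ D C

  q : ℕ → Series
  q = Q z₀

  v^∗z₀ : ∀ m → v ^ m ∗ z₀ S.+ v ^ suc m ∗ D C S.≈ v ^ m
  v^∗z₀ m = SR.begin
    v ^ m ∗ (1s S.- v ∗ D C) S.+ v ^ suc m ∗ D C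
      SR.≈⟨ S.+-cong (S.distribˡ (v ^ m) 1s (S.- (v ∗ D C))) (swap v (v ^ m) (D C)) ⟩
    (v ^ m ∗ 1s S.+ v ^ m ∗ (S.- (v ∗ D C))) S.+ v ^ m ∗ (v ∗ D C)
      SR.≈⟨ S.+-assoc _ _ _ ⟩
    v ^ m ∗ 1s S.+ (v ^ m ∗ (S.- (v ∗ D C)) S.+ v ^ m ∗ (v ∗ D C))
      SR.≈⟨ S.+-cong (S.*-identityʳ _) (S.sym (S.distribˡ (v ^ m) _ _)) ⟩
    v ^ m S.+ v ^ m ∗ ((S.- (v ∗ D C)) S.+ v ∗ D C)
      SR.≈⟨ S.+-congˡ (S.trans (S.*-congˡ {v ^ m} (S.-‿inverseˡ (v ∗ D C))) (S.zeroʳ (v ^ m))) ⟩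
    v ^ m S.+ 0s
      SR.≈⟨ S.+-identityʳ _ ⟩
    v ^ m SR.∎
    where
    open NaturalSolver S.commutativeSemiring
    swap : ∀ a b d → a ∗ b ∗ d S.≈ b ∗ (a ∗ d)
    swap = solve 3 (λ a b d → a :* b :* d := b :* (a :* d)) S.refl

  -- By `D-v^`, `m` times v^(m+1)·D C is D(v^m), whose coefficient is n·y; hence m·q + n·y = (s +
  -- n)·y. The case `s` = 0 yields `q₀≈1`, and `s` = 1 identifies `q 1` with the series G of
  -- `lagrange`.
  q-coefficient : ∀ s n → (s ℕ.+ n) × q s n ≈ s × (v ^ (s ℕ.+ n)) n
  q-coefficient s n = +-cancelʳ (n × y) _ _ (begin
    m × q s n + n × y                         ≈⟨ +-congˡ (D-v^ m n) ⟩
    m × q s n + (m SM.× (v ^ suc m ∗ D C)) n  ≈⟨ +-congˡ (×-coefficient m (v ^ suc m ∗ D C) n) ⟩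
    m × q s n + m × (v ^ suc m ∗ D C) n       ≈⟨ ×-distrib-+ _ _ m ⟨
    m × (q s n + (v ^ suc m ∗ D C) n)         ≈⟨ ×-congʳ m (v^∗z₀ m n) ⟩
    m × y                                     ≈⟨ ×-homo-+ y s n ⟩
    s × y + n × y ∎)
    where
    open RingProperties ring using (+-cancelʳ)
    m = s ℕ.+ n
    y = (v ^ m) n

  q₀≈1 : q 0 S.≈ 1s
  -- Degree 0 is computed directly, because there `q-coefficient` only says 0 = 0.
  q₀≈1 zero = begin
    1# * (1# - v 0 * 0#) ≈⟨ *-identityˡ _ ⟩
    1# - v 0 * 0#        ≈⟨ +-congˡ (trans (-‿distribʳ-* _ _) (trans (*-congˡ -0#≈0#) (zeroʳ _))) ⟩
    1# + 0#              ≈⟨ +-identityʳ _ ⟩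
    1# ∎
    where
    open RingProperties ring using (-0#≈0#)
  q₀≈1 (suc n) = ×-cancelˡ n (trans (q-coefficient 0 (suc n)) (sym (×-zeroʳ (suc n))))

  -- As families in `s`, both sides satisfy the recurrence, and they agree at `s` = 0 because `q 0`
  -- is 1.
  Q∗q : ∀ z t s → Q z t ∗ q s S.≈ Q z (s ℕ.+ t)
  Q∗q z t = recurrent-unique (recurrent-∗ (Q z t) (Q-recurrent z₀))
    (recurrent-shift t (Q-recurrent z))
    (S.trans (S.*-congˡ {Q z t} q₀≈1) (S.*-identityʳ (Q z t)))

  q≈q₁^ : ∀ s → q s S.≈ q 1 ^ s
  q≈q₁^ zero    = q₀≈1
  q≈q₁^ (suc s) = SR.begin
    q (suc s)      SR.≈⟨ Q∗q z₀ s 1 ⟨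
    q s ∗ q 1      SR.≈⟨ S.*-comm (q s) (q 1) ⟩
    q 1 ∗ q s      SR.≈⟨ S.*-congˡ {q 1} (q≈q₁^ s) ⟩
    q 1 ^ suc s    SR.∎

  -- [xᵐ] G⁻⁽ᵐ⁺¹⁾ = (m + 1) uₘ for m ≥ 1, where uₘ = − Cₘ.
  lagrange : ∀ G w → (∀ n → suc n × G n ≈ (v ^ suc n) n) → G ∗ w S.≈ 1s →
    ∀ n → let m = suc n in (w ^ suc m) m + suc m × C m ≈ 0#
  lagrange G w G-coefficient G∗w≈1 n = begin
    (w ^ suc m) m + suc m × C m              ≈⟨ +-congʳ (w^≈Q m) ⟩
    -- `suc m × C m` unfolds to `C m + m × C m`, and `m × C m` is `D C m`.
    (v ^ m ∗ (u ^ suc m ∗ z₀)) m + (C m + m × C m) ≈⟨ +-congʳ (reduce m) ⟩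
    (u ∗ z₀) m + (C m + D C m)               ≈⟨ +-congˡ (+-comm _ _) ⟩
    (u ∗ z₀) m + (D C m + C m)               ≈⟨ +-assoc _ _ _ ⟨
    ((u ∗ z₀) m + D C m) + C m               ≈⟨ +-congʳ (u∗z₀ m) ⟩
    (0# - C m) + C m                         ≈⟨ trans (+-assoc _ _ _) (+-identityˡ _) ⟩
    - C m + C m                              ≈⟨ -‿inverseˡ _ ⟩
    0# ∎
    where
    m = suc n
    -- Chosen so that `Q z (suc m)` becomes `q 0`, which is 1. Then `Q z 0` is inverse to
    -- `q (suc m)`, the power G^(m+1), while its coefficient in degree `m` reduces to that of
    -- `u ∗ z₀`.
    z = u ^ suc m ∗ z₀
    open NaturalSolver S.commutativeSemiring
    q₁≈G : q 1 S.≈ G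
    q₁≈G k = ×-cancelˡ k (trans (q-coefficient 1 k) (trans (+-identityʳ _) (sym (G-coefficient k))))
    v^u^ : ∀ k → v ^ k ∗ u ^ k S.≈ 1s
    v^u^ k = ^-inverse v u k (S.trans (S.*-comm v u) u∗v)
    cancel-v^ : ∀ k → v ^ k ∗ (u ^ k ∗ z₀) S.≈ z₀
    cancel-v^ k = S.trans (S.sym (S.*-assoc (v ^ k) (u ^ k) z₀)) (S.trans (S.*-congʳ (v^u^ k)) (S.*-identityˡ z₀))
    reduce : v ^ m ∗ z S.≈ u ∗ z₀
    reduce = S.trans (solve 4 (λ a x y d → x :* (a :* y :* d) := a :* (x :* (y :* d))) S.refl u (v ^ m) (u ^ m) z₀)
      (S.*-congˡ {u} (cancel-v^ m))
    u∗z₀ : u ∗ z₀ S.+ D C S.≈ u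
    u∗z₀ = SR.begin
      u ∗ z₀ S.+ D C
        SR.≈⟨ S.+-cong (S.*-identityˡ _) (S.trans (S.*-congʳ u∗v) (S.trans (S.*-identityˡ _) (S.*-identityˡ _))) ⟨
      1s ∗ (u ∗ z₀) S.+ (u ∗ v) ∗ (1s ∗ D C)
        SR.≈⟨ solve 5 (λ o a x y d → o :* (a :* x) :+ (a :* y) :* (o :* d) := a :* (o :* x :+ (y :* o) :* d))
              S.refl 1s u z₀ v (D C) ⟩
      u ∗ (v ^ 0 ∗ z₀ S.+ v ^ 1 ∗ D C)
        SR.≈⟨ S.*-congˡ {u} (v^∗z₀ 0) ⟩
      u ∗ 1s
        SR.≈⟨ S.*-identityʳ u ⟩
      u SR.∎
    Q-z : Q z (suc m ℕ.+ 0) S.≈ 1s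
    Q-z k = begin
      (v ^ (suc m ℕ.+ 0 ℕ.+ k) ∗ z) k
        ≈⟨ reflexive (≡.cong (λ i → (v ^ (i ℕ.+ k) ∗ z) k) (ℕₚ.+-identityʳ (suc m))) ⟩
      (v ^ (suc m ℕ.+ k) ∗ z) k
        ≈⟨ S.*-congʳ {z} (^-homo-* v (suc m) k) k ⟩
      ((v ^ suc m ∗ v ^ k) ∗ z) k
        ≈⟨ solve 4 (λ a x y d → (x :* a) :* (y :* d) := a :* (x :* (y :* d))) S.refl (v ^ k) (v ^ suc m) (u ^ suc m) z₀ k ⟩
      (v ^ k ∗ (v ^ suc m ∗ (u ^ suc m ∗ z₀))) k
        ≈⟨ S.*-congˡ {v ^ k} (cancel-v^ (suc m)) k ⟩
      q 0 k
        ≈⟨ q₀≈1 k ⟩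
      1s k ∎
    w^≈Q : w ^ suc m S.≈ Q z 0
    w^≈Q = SR.begin
      w ^ suc m                              SR.≈⟨ S.*-identityʳ _ ⟨
      w ^ suc m ∗ 1s                         SR.≈⟨ S.*-congˡ {w ^ suc m} Q-z ⟨
      w ^ suc m ∗ Q z (suc m ℕ.+ 0)          SR.≈⟨ S.*-congˡ {w ^ suc m} (Q∗q z 0 (suc m)) ⟨
      w ^ suc m ∗ (Q z 0 ∗ q (suc m))
        SR.≈⟨ S.*-congˡ {w ^ suc m} (S.*-congˡ {Q z 0}
          (S.trans (q≈q₁^ (suc m)) (^-congˡ (suc m) q₁≈G))) ⟩
      w ^ suc m ∗ (Q z 0 ∗ G ^ suc m)
        SR.≈⟨ solve 3 (λ a b d → a :* (b :* d) := b :* (d :* a)) S.refl (w ^ suc m) (Q z 0) (G ^ suc m) ⟩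
      Q z 0 ∗ (G ^ suc m ∗ w ^ suc m)        SR.≈⟨ S.*-congˡ {Q z 0} (^-inverse G w (suc m) G∗w≈1) ⟩
      Q z 0 ∗ 1s                             SR.≈⟨ S.*-identityʳ (Q z 0) ⟩
      Q z 0 SR.∎

-- Existence of the geometric series.

module GeometricSeries {c ℓ} (R : CommutativeRing c ℓ)
  (C : Series.Series R) (C₀≈0 : Series.ZeroConstant R C) where
  open CommutativeRing R
  open Series R
  open SetoidReasoning setoid

  partial : ℕ → Series
  partial zero    = 1s
  partial (suc k) n = 1s n + (C ∗ partial k) n

  -- `partial k` is 1 + C + ... + C^k, and the diagonal is its x-adic limit: as `C 0` vanishes, the
  -- coefficient in degree `n` is stable from `k = n` on.
  geometric : Series
  geometric n = partial n n

  partial-stable : ∀ k n → n ℕ.≤ k → partial (suc k) n ≈ partial k n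
  partial-stable zero    zero ℕ.z≤n = trans (+-congˡ (*-nullˡ _ C₀≈0)) (+-identityʳ _)
  partial-stable (suc k) n    n≤k   = +-congˡ (⋆-cong-positive C₀≈0 n λ i j e →
    partial-stable k j (ℕₚ.≤-pred (ℕₚ.≤-trans (ℕ.s≤s (ℕₚ.m≤n+m j i)) (ℕₚ.≤-trans (ℕₚ.≤-reflexive e) n≤k))))

  partial≈geometric : ∀ d n → partial (d ℕ.+ n) n ≈ geometric n
  partial≈geometric zero    n = refl
  partial≈geometric (suc d) n = trans (partial-stable (d ℕ.+ n) n (ℕₚ.m≤n+m n d)) (partial≈geometric d n)

  geometric-fix : ∀ n → geometric n ≈ 1s n + (C ∗ geometric) n
  geometric-fix n = begin
    partial n n                     ≈⟨ partial-stable n n ℕₚ.≤-refl ⟨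
    -- In the term of degree `j` the stage is n = k + j, past the point where that coefficient is
    -- stable.
    1s n + (C ∗ partial n) n        ≈⟨ +-congˡ (⋆-cong (λ _ → refl) n λ k j e →
      trans (reflexive (≡.cong (λ i → partial i j) (≡.sym e))) (partial≈geometric k j)) ⟩
    1s n + (C ∗ geometric) n        ∎

-- Finite sums and divided-power sums over truncated exponent tuples.

module RangeSums {c ℓ} (R : CommutativeRing c ℓ) where
  open CommutativeRing R
  open NaturalSolver commutativeSemiring using (solve; _:+_; _:=_)

  -- Opaque, so that unification can read summands off equations between sums.
  opaque
    sumTo : ℕ → (ℕ → Carrier) → Carrier
    sumTo zero    f = 0#
    sumTo (suc n) f = f 0 + sumTo n (f ∘ suc)

    sumTo-empty : ∀ (f : ℕ → Carrier) → sumTo 0 f ≡ 0#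
    sumTo-empty f = ≡.refl

    sumTo-suc : ∀ n f → sumTo (suc n) f ≡ f 0 + sumTo n (f ∘ suc)
    sumTo-suc n f = ≡.refl

    sumTo-cong : ∀ n {f g} → (∀ i → f i ≈ g i) → sumTo n f ≈ sumTo n g
    sumTo-cong zero    p = refl
    sumTo-cong (suc n) p = +-cong (p 0) (sumTo-cong n (p ∘ suc))

    sumTo-zero : ∀ n {f} → (∀ i → f i ≈ 0#) → sumTo n f ≈ 0#
    sumTo-zero zero    p = refl
    sumTo-zero (suc n) p = trans (+-cong (p 0) (sumTo-zero n (p ∘ suc))) (+-identityˡ 0#)

    sumTo-+ : ∀ n f g → sumTo n (λ i → f i + g i) ≈ sumTo n f + sumTo n g
    sumTo-+ zero    f g = sym (+-identityˡ 0#)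
    sumTo-+ (suc n) f g = trans (+-congˡ (sumTo-+ n (f ∘ suc) (g ∘ suc)))
      (solve 4 (λ x y z w → (x :+ y) :+ (z :+ w) := (x :+ z) :+ (y :+ w)) refl _ _ _ _)

    sumTo-* : ∀ n x f → sumTo n (λ i → x * f i) ≈ x * sumTo n f
    sumTo-* zero    x f = sym (zeroʳ x)
    sumTo-* (suc n) x f = trans (+-congˡ (sumTo-* n x (f ∘ suc))) (sym (distribˡ _ _ _))

    sumTo-last : ∀ n f → sumTo (suc n) f ≈ sumTo n f + f n
    sumTo-last zero    f = +-comm _ _
    sumTo-last (suc n) f = trans (+-congˡ (sumTo-last n (f ∘ suc))) (sym (+-assoc _ _ _))

    sumTo-swap : ∀ m n (f : ℕ → ℕ → Carrier) → sumTo m (λ i → sumTo n (f i)) ≈ sumTo n (λ j → sumTo m (λ i → f i j))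
    sumTo-swap zero    n f = sym (sumTo-zero n {λ _ → 0#} (λ _ → refl))
    sumTo-swap (suc m) n f = trans (+-congˡ (sumTo-swap m n (f ∘ suc)))
      (sym (sumTo-+ n (f 0) (λ j → sumTo m (λ i → f (suc i) j))))

module TupleSums {c ℓ} (R : CommutativeRing c ℓ)
  (inv! : Series.Series R) (inv!-laws : Series.ReciprocalFactorials R inv!)
  (γ : Series.Series R) (b : ℕ) where
  open CommutativeRing R
  open Mult semiring
  open Series R using (module ReciprocalFactorials)
  open ReciprocalFactorials inv!-laws
  open Exp semiring using (_^_)
  open NaturalSolver commutativeSemiring using (solve; _:*_; _:=_)
  open RangeSums R
  open SetoidReasoning setoid

  divPow : ℕ → ℕ → Carrier
  divPow j a = γ j ^ a * inv! a

  -- L j m f = Σ γⱼ^k₀ ⋯ γⱼ₊ₘ₋₁^kₘ₋₁ / (k₀! ⋯ kₘ₋₁!) f(w, s) over all k₀, …, kₘ₋₁ ≤ b, where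
  -- w = j k₀ + ⋯ + (j + m − 1) kₘ₋₁ and s = k₀ + ⋯ + kₘ₋₁.
  opaque
    L : ℕ → ℕ → (ℕ → ℕ → Carrier) → Carrier
    L j zero    f = f 0 0
    L j (suc m) f = sumTo (suc b) λ a → divPow j a * L (suc j) m (λ w s → f (j ℕ.* a ℕ.+ w) (a ℕ.+ s))

    L-zero-variables : ∀ j (f : ℕ → ℕ → Carrier) → L j 0 f ≡ f 0 0
    L-zero-variables j f = ≡.refl

    L-suc : ∀ j m f → L j (suc m) f ≡
      sumTo (suc b) λ a → divPow j a * L (suc j) m (λ w s → f (j ℕ.* a ℕ.+ w) (a ℕ.+ s))
    L-suc j m f = ≡.refl

    L-cong : ∀ j m {f g} → (∀ w s → f w s ≈ g w s) → L j m f ≈ L j m g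
    L-cong j zero    p = p 0 0
    L-cong j (suc m) p = sumTo-cong (suc b) λ a → *-congˡ (L-cong (suc j) m (λ w s → p _ _))

    L-zero : ∀ j m {f} → (∀ w s → f w s ≈ 0#) → L j m f ≈ 0#
    L-zero j zero    p = p 0 0
    L-zero j (suc m) {f} p = sumTo-zero (suc b) λ a →
      trans (*-congˡ (L-zero (suc j) m (λ w s → p _ _))) (zeroʳ _)

    L-+ : ∀ j m f g → L j m (λ w s → f w s + g w s) ≈ L j m f + L j m g
    L-+ j zero    f g = refl
    L-+ j (suc m) f g = trans
      (sumTo-cong (suc b) λ a → trans (*-congˡ (L-+ (suc j) m _ _)) (distribˡ _ _ _))
      (sumTo-+ (suc b) _ _)

    L-× : ∀ j m n f → L j m (λ w s → n × f w s) ≈ n × L j m f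
    L-× j m zero    f = L-zero j m (λ _ _ → refl)
    L-× j m (suc n) f = trans (L-+ j m f _) (+-congˡ (L-× j m n f))

  divPow-suc : ∀ j a → suc a × divPow j (suc a) ≈ γ j * divPow j a
  divPow-suc j a = begin
    suc a × (γ j ^ suc a * inv! (suc a))   ≈⟨ ×-comm-* (suc a) _ _ ⟨
    γ j ^ suc a * (suc a × inv! (suc a))   ≈⟨ *-congˡ (inv!-suc a) ⟩
    γ j * γ j ^ a * inv! a                 ≈⟨ *-assoc _ _ _ ⟩
    γ j * divPow j a                       ∎

  -- The left term at `a` = 0 vanishes and `divPow-suc` reindexes the others. The right side then
  -- has one surplus term, at `a` = `b`, which the hypothesis on `e` kills.
  sum-by-parts : ∀ j (e : ℕ → Carrier) → e (suc b) ≈ 0# →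
    sumTo (suc b) (λ a → (a × divPow j a) * e a) ≈ γ j * sumTo (suc b) (λ a → divPow j a * e (suc a))
  sum-by-parts j e e≈0 = begin
    sumTo (suc b) (λ a → (a × divPow j a) * e a)
      ≡⟨ sumTo-suc b _ ⟩
    0# * e 0 + sumTo b (λ a → (suc a × divPow j (suc a)) * e (suc a))
      ≈⟨ trans (+-congʳ (zeroˡ _)) (+-identityˡ _) ⟩
    sumTo b (λ a → (suc a × divPow j (suc a)) * e (suc a))
      ≈⟨ sumTo-cong b (λ a → trans (*-congʳ (divPow-suc j a)) (*-assoc _ _ _)) ⟩
    sumTo b (λ a → γ j * (divPow j a * e (suc a)))
      ≈⟨ sumTo-* b (γ j) _ ⟩
    γ j * sumTo b (λ a → divPow j a * e (suc a))
      ≈⟨ *-congˡ (trans (+-congˡ (trans (*-congˡ e≈0) (zeroʳ _))) (+-identityʳ _)) ⟨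
    γ j * (sumTo b (λ a → divPow j a * e (suc a)) + divPow j b * e (suc b))
      ≈⟨ *-congˡ (sumTo-last b _) ⟨
    γ j * sumTo (suc b) (λ a → divPow j a * e (suc a)) ∎

  -- Euler's identity k·γᵏ/k! = γ·γᵏ⁻¹/(k − 1)! in each variable; the support condition on f makes the
  -- truncation at b harmless.
  L-by-parts : ∀ x y m j (f : ℕ → ℕ → Carrier) → (∀ w s → b ℕ.< w → f w s ≈ 0#) →
    L (suc j) m (λ w s → (x ℕ.* w ℕ.+ y ℕ.* s) × f w s) ≈
    sumTo m (λ i → ((x ℕ.* (suc j ℕ.+ i) ℕ.+ y) × γ (suc j ℕ.+ i)) *
                   L (suc j) m (λ w s → f (suc j ℕ.+ i ℕ.+ w) (suc s)))
  L-by-parts x y zero    j f f≈0 = begin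
    L (suc j) 0 (λ w s → (x ℕ.* w ℕ.+ y ℕ.* s) × f w s)   ≡⟨ L-zero-variables (suc j) _ ⟩
    (x ℕ.* 0 ℕ.+ y ℕ.* 0) × f 0 0    ≈⟨ ×-congˡ (≡.cong₂ ℕ._+_ (ℕₚ.*-zeroʳ x) (ℕₚ.*-zeroʳ y)) ⟩
    0#                               ≡⟨ sumTo-empty _ ⟨
    sumTo 0 _                        ∎
  L-by-parts x y (suc m) j f f≈0 = begin
    L J (suc m) (λ w s → (x ℕ.* w ℕ.+ y ℕ.* s) × f w s)
      ≡⟨ L-suc J m _ ⟩
    sumTo (suc b) (λ a → divPow J a * L (suc J) m (λ w s → (x ℕ.* (J ℕ.* a ℕ.+ w) ℕ.+ y ℕ.* (a ℕ.+ s)) × fₐ a w s))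
      ≈⟨ sumTo-cong (suc b) (λ a → *-congˡ (split a)) ⟩
    sumTo (suc b) (λ a → divPow J a * ((κ ℕ.* a) × L (suc J) m (fₐ a) + rest a))
      ≈⟨ trans (sumTo-cong (suc b) (λ a → distribˡ _ _ _)) (sumTo-+ (suc b) _ _) ⟩
    sumTo (suc b) (λ a → divPow J a * ((κ ℕ.* a) × L (suc J) m (fₐ a))) + sumTo (suc b) (λ a → divPow J a * rest a)
      ≈⟨ +-cong head-part tail-part ⟩
    _ + sumTo m _
      ≡⟨ sumTo-suc m _ ⟨
    sumTo (suc m) (λ i → ((x ℕ.* (J ℕ.+ i) ℕ.+ y) × γ (J ℕ.+ i)) *
                         L J (suc m) (λ w s → f (J ℕ.+ i ℕ.+ w) (suc s))) ∎
    where
    J κ : ℕ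
    J = suc j
    -- Raising the first exponent by one raises x·w + y·s by this amount.
    κ = x ℕ.* J ℕ.+ y
    fₐ : ℕ → ℕ → ℕ → Carrier
    fₐ a w s = f (J ℕ.* a ℕ.+ w) (a ℕ.+ s)
    rest : ℕ → Carrier
    rest a = L (suc J) m (λ w s → (x ℕ.* w ℕ.+ y ℕ.* s) × fₐ a w s)
    expand : ∀ a w s → x ℕ.* (J ℕ.* a ℕ.+ w) ℕ.+ y ℕ.* (a ℕ.+ s) ≡ κ ℕ.* a ℕ.+ (x ℕ.* w ℕ.+ y ℕ.* s)
    expand a w s = ℕSolver.+-*-Solver.solve 6
      (λ x J a w y s → x :*ₙ (J :*ₙ a :+ₙ w) :+ₙ y :*ₙ (a :+ₙ s) :=ₙ (x :*ₙ J :+ₙ y) :*ₙ a :+ₙ (x :*ₙ w :+ₙ y :*ₙ s))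
      ≡.refl x J a w y s
      where
      open ℕSolver.+-*-Solver using () renaming (_:+_ to _:+ₙ_; _:*_ to _:*ₙ_; _:=_ to _:=ₙ_)
    split : ∀ a → L (suc J) m (λ w s → (x ℕ.* (J ℕ.* a ℕ.+ w) ℕ.+ y ℕ.* (a ℕ.+ s)) × fₐ a w s) ≈
      (κ ℕ.* a) × L (suc J) m (fₐ a) + rest a
    split a = begin
      L (suc J) m (λ w s → (x ℕ.* (J ℕ.* a ℕ.+ w) ℕ.+ y ℕ.* (a ℕ.+ s)) × fₐ a w s)
        ≈⟨ L-cong (suc J) m (λ w s → trans (×-congˡ (expand a w s)) (×-homo-+ _ (κ ℕ.* a) _)) ⟩
      L (suc J) m (λ w s → (κ ℕ.* a) × fₐ a w s + (x ℕ.* w ℕ.+ y ℕ.* s) × fₐ a w s)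
        ≈⟨ L-+ (suc J) m _ _ ⟩
      L (suc J) m (λ w s → (κ ℕ.* a) × fₐ a w s) + rest a
        ≈⟨ +-congʳ (L-× (suc J) m (κ ℕ.* a) (fₐ a)) ⟩
      (κ ℕ.* a) × L (suc J) m (fₐ a) + rest a ∎
    -- The first variable yields the summand `i` = 0. The others yield the summands `suc i` in
    -- `tail-part`, by recursion with the first exponent `a` fixed.
    head-part : sumTo (suc b) (λ a → divPow J a * ((κ ℕ.* a) × L (suc J) m (fₐ a))) ≈
      ((x ℕ.* (J ℕ.+ 0) ℕ.+ y) × γ (J ℕ.+ 0)) * L J (suc m) (λ w s → f (J ℕ.+ 0 ℕ.+ w) (suc s))
    head-part = begin
      sumTo (suc b) (λ a → divPow J a * ((κ ℕ.* a) × e a))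
        ≈⟨ sumTo-cong (suc b) (λ a → factor (divPow J a) (e a) a) ⟩
      sumTo (suc b) (λ a → (κ × 1#) * ((a × divPow J a) * e a))
        ≈⟨ sumTo-* (suc b) (κ × 1#) _ ⟩
      (κ × 1#) * sumTo (suc b) (λ a → (a × divPow J a) * e a)
        ≈⟨ *-congˡ (sum-by-parts J e e≈0) ⟩
      (κ × 1#) * (γ J * sumTo (suc b) (λ a → divPow J a * e (suc a)))
        ≈⟨ *-assoc _ _ _ ⟨
      (κ × 1#) * γ J * sumTo (suc b) (λ a → divPow J a * e (suc a))
        ≈⟨ *-cong coefficient (sumTo-cong (suc b) (λ a → *-congˡ (L-cong (suc J) m (λ w s →
             reflexive (≡.cong (λ i → f i (suc (a ℕ.+ s))) (shift a w)))))) ⟩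
      κ₀ × γ (J ℕ.+ 0) * sumTo (suc b) (λ a → divPow J a *
          L (suc J) m (λ w s → f (J ℕ.+ 0 ℕ.+ (J ℕ.* a ℕ.+ w)) (suc (a ℕ.+ s))))
        ≡⟨ ≡.cong (κ₀ × γ (J ℕ.+ 0) *_) (L-suc J m _) ⟨
      κ₀ × γ (J ℕ.+ 0) * L J (suc m) (λ w s → f (J ℕ.+ 0 ℕ.+ w) (suc s)) ∎
      where
      κ₀ : ℕ
      κ₀ = x ℕ.* (J ℕ.+ 0) ℕ.+ y
      e : ℕ → Carrier
      e a = L (suc J) m (fₐ a)
      -- The weight is at least J·(b + 1), which exceeds `b` because the index `J` is positive.
      e≈0 : e (suc b) ≈ 0#
      e≈0 = L-zero (suc J) m (λ w s → f≈0 _ _ (ℕₚ.≤-trans (ℕₚ.m≤n*m (suc b) J) (ℕₚ.m≤m+n _ w)))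
      factor : ∀ p z a → p * ((κ ℕ.* a) × z) ≈ (κ × 1#) * ((a × p) * z)
      factor p z a = begin
        p * ((κ ℕ.* a) × z)          ≈⟨ ×-comm-* (κ ℕ.* a) p z ⟩
        (κ ℕ.* a) × (p * z)          ≈⟨ ×-assocˡ (p * z) κ a ⟨
        κ × (a × (p * z))            ≈⟨ ×-congʳ κ (×-assoc-* a p z) ⟨
        κ × ((a × p) * z)            ≈⟨ ×-congʳ κ (*-identityˡ _) ⟨
        κ × (1# * ((a × p) * z))     ≈⟨ ×-assoc-* κ _ _ ⟨
        (κ × 1#) * ((a × p) * z)     ∎
      coefficient : (κ × 1#) * γ J ≈ κ₀ × γ (J ℕ.+ 0)
      coefficient = begin
        (κ × 1#) * γ J       ≈⟨ ×-assoc-* κ _ _ ⟩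
        κ × (1# * γ J)       ≈⟨ ×-congʳ κ (*-identityˡ _) ⟩
        κ × γ J              ≡⟨ ≡.cong (λ i → (x ℕ.* i ℕ.+ y) × γ i) (ℕₚ.+-identityʳ J) ⟨
        κ₀ × γ (J ℕ.+ 0)     ∎
      shift : ∀ a w → J ℕ.* suc a ℕ.+ w ≡ J ℕ.+ 0 ℕ.+ (J ℕ.* a ℕ.+ w)
      shift a w = ≡.trans (≡.cong (ℕ._+ w) (ℕₚ.*-suc J a))
        (≡.trans (ℕₚ.+-assoc J (J ℕ.* a) w) (≡.cong (ℕ._+ (J ℕ.* a ℕ.+ w)) (≡.sym (ℕₚ.+-identityʳ J))))
    tail-part : sumTo (suc b) (λ a → divPow J a * rest a) ≈
      sumTo m (λ i → ((x ℕ.* (J ℕ.+ suc i) ℕ.+ y) × γ (J ℕ.+ suc i)) *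
                     L J (suc m) (λ w s → f (J ℕ.+ suc i ℕ.+ w) (suc s)))
    tail-part = begin
      sumTo (suc b) (λ a → divPow J a * rest a)
        ≈⟨ sumTo-cong (suc b) (λ a → *-congˡ (L-by-parts x y m J (fₐ a)
             (λ w s b<w → f≈0 _ _ (ℕₚ.<-≤-trans b<w (ℕₚ.m≤n+m w (J ℕ.* a)))))) ⟩
      sumTo (suc b) (λ a → divPow J a * sumTo m (λ i → κᵢ i * l i a))
        ≈⟨ sumTo-cong (suc b) (λ a → sumTo-* m (divPow J a) _) ⟨
      sumTo (suc b) (λ a → sumTo m (λ i → divPow J a * (κᵢ i * l i a)))
        ≈⟨ sumTo-swap (suc b) m _ ⟩
      sumTo m (λ i → sumTo (suc b) (λ a → divPow J a * (κᵢ i * l i a)))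
        ≈⟨ sumTo-cong m (λ i → trans (sumTo-cong (suc b) (λ a → exchange _ _ _)) (sumTo-* (suc b) (κᵢ i) _)) ⟩
      sumTo m (λ i → κᵢ i * sumTo (suc b) (λ a → divPow J a * l i a))
        ≈⟨ sumTo-cong m (λ i → *-cong
             (reflexive (≡.cong (λ k → (x ℕ.* k ℕ.+ y) × γ k) (≡.sym (ℕₚ.+-suc J i)))) (unfold i)) ⟩
      sumTo m (λ i → ((x ℕ.* (J ℕ.+ suc i) ℕ.+ y) × γ (J ℕ.+ suc i)) *
                     L J (suc m) (λ w s → f (J ℕ.+ suc i ℕ.+ w) (suc s))) ∎
      where
      κᵢ : ℕ → Carrier
      κᵢ i = (x ℕ.* (suc J ℕ.+ i) ℕ.+ y) × γ (suc J ℕ.+ i)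
      l : ℕ → ℕ → Carrier
      l i a = L (suc J) m (λ w s → fₐ a (suc J ℕ.+ i ℕ.+ w) (suc s))
      exchange : ∀ p q z → p * (q * z) ≈ q * (p * z)
      exchange = solve 3 (λ p q z → p :* (q :* z) := q :* (p :* z)) refl
      move : ∀ i a w → J ℕ.* a ℕ.+ (suc J ℕ.+ i ℕ.+ w) ≡ J ℕ.+ suc i ℕ.+ (J ℕ.* a ℕ.+ w)
      move i a w = ℕSolver.+-*-Solver.solve 4
        (λ j i p w → p :+ₙ (con 2 :+ₙ j :+ₙ i :+ₙ w) :=ₙ (con 1 :+ₙ j) :+ₙ (con 1 :+ₙ i) :+ₙ (p :+ₙ w))
        ≡.refl j i (J ℕ.* a) w
        where
        open ℕSolver.+-*-Solver using (con) renaming (_:+_ to _:+ₙ_; _:=_ to _:=ₙ_)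
      unfold : ∀ i → sumTo (suc b) (λ a → divPow J a * l i a) ≈ L J (suc m) (λ w s → f (J ℕ.+ suc i ℕ.+ w) (suc s))
      unfold i = begin
        sumTo (suc b) (λ a → divPow J a * l i a)
          ≈⟨ sumTo-cong (suc b) (λ a → *-congˡ (L-cong (suc J) m (λ w s →
               reflexive (≡.cong₂ f (move i a w) (ℕₚ.+-suc a s))))) ⟩
        sumTo (suc b) (λ a → divPow J a * L (suc J) m (λ w s → f (J ℕ.+ suc i ℕ.+ (J ℕ.* a ℕ.+ w)) (suc (a ℕ.+ s))))
          ≡⟨ L-suc J m _ ⟨
        L J (suc m) (λ w s → f (J ℕ.+ suc i ℕ.+ w) (suc s)) ∎

-- Tuple sums of fixed weight as coefficients of powers of v.

module TupleCoefficients {c ℓ} (R : CommutativeRing c ℓ)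
  (×-cancelˡ : Series.TorsionFree R)
  (inv! : Series.Series R) (inv!-laws : Series.ReciprocalFactorials R inv!)
  (γ v : Series.Series R) (γ₀≈0 : Series.ZeroConstant R γ) (v-fix : Series.Geometric R γ v)
  (b : ℕ) where
  open CommutativeRing R
  open Mult semiring
  open Series R
  open ReciprocalFactorials inv!-laws using (inv!-zero)
  open Derivation R
  open GeometricInverse γ v v-fix
  open RangeSums R
  open TupleSums R inv! inv!-laws γ b
  open SetoidReasoning setoid

  -- Written with `≡ᵇ` because `does (w ≟ n)` computes to it, so filtering by weight turns into this
  -- indicator by definition.
  at : ℕ → ℕ → Carrier → Carrier
  at n w x = if w ℕ.≡ᵇ n then x else 0#

  at-≡ : ∀ {n w} x → w ≡ n → at n w x ≡ x
  at-≡ {n} x ≡.refl with n ℕ.≡ᵇ n | ℕₚ.≡⇒≡ᵇ n n ≡.refl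
  ... | true | _ = ≡.refl

  at-≢ : ∀ {n w} x → ¬ w ≡ n → at n w x ≡ 0#
  at-≢ {n} {w} x w≢n with w ℕ.≡ᵇ n | ℕₚ.≡ᵇ⇒≡ w n
  ... | true  | w≡n = ⊥-elim (w≢n (w≡n _))
  ... | false | _   = ≡.refl

  at-shift : ∀ {n k} i w x → i ℕ.+ k ≡ n → at n (i ℕ.+ w) x ≡ at k w x
  at-shift {n} {k} i w x e with w ℕₚ.≟ k
  ... | yes ≡.refl = ≡.trans (at-≡ x e) (≡.sym (at-≡ {k} x ≡.refl))
  ... | no w≢k = ≡.trans (at-≢ x (λ e′ → w≢k (ℕₚ.+-cancelˡ-≡ i w k (≡.trans e′ (≡.sym e))))) (≡.sym (at-≢ x w≢k))

  -- Reconciles the fixed range of variables in `L-by-parts` with the range of a convolution, which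
  -- depends on the degree.
  sumTo-∗ : ∀ m n (a h e : Series) → n ℕ.< m →
    (∀ i k → i ℕ.+ k ≡ n → e i ≈ h k) → (∀ i → n ℕ.< i → e i ≈ 0#) →
    sumTo m (λ i → a i * e i) ≈ (a ∗ h) n
  sumTo-∗ (suc m) n a h e n<m e≈h e≈0 = begin
    sumTo (suc m) (λ i → a i * e i)                      ≡⟨ sumTo-suc m _ ⟩
    a 0 * e 0 + sumTo m (λ i → a (suc i) * e (suc i))    ≈⟨ +-congʳ (*-congˡ (e≈h 0 n ≡.refl)) ⟩
    a 0 * h n + sumTo m (λ i → a (suc i) * e (suc i))    ≈⟨ rest n n<m e≈h e≈0 ⟩
    (a ∗ h) n                                            ∎
    where
    rest : ∀ n → n ℕ.< suc m →
      (∀ i k → i ℕ.+ k ≡ n → e i ≈ h k) → (∀ i → n ℕ.< i → e i ≈ 0#) →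
      a 0 * h n + sumTo m (λ i → a (suc i) * e (suc i)) ≈ (a ∗ h) n
    rest zero    _   _   e≈0 = trans
      (+-congˡ (sumTo-zero m (λ i → trans (*-congˡ (e≈0 (suc i) (ℕ.s≤s ℕ.z≤n))) (zeroʳ _)))) (+-identityʳ _)
    rest (suc n) n<m e≈h e≈0 = +-congˡ (sumTo-∗ m n (tail a) h (e ∘ suc) (ℕₚ.≤-pred n<m)
      (λ i k p → e≈h (suc i) k (≡.cong suc p)) (λ i n<i → e≈0 (suc i) (ℕ.s≤s n<i)))

  -- Variable indices start at `suc j`, so every nonzero tuple has positive weight and only the zero
  -- tuple survives.
  L-origin : ∀ j m (f : ℕ → ℕ → Carrier) → (∀ w s → f (suc w) s ≈ 0#) → L (suc j) m f ≈ f 0 0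
  L-origin j zero    f f≈0 = reflexive (L-zero-variables (suc j) f)
  L-origin j (suc m) f f≈0 = begin
    L (suc j) (suc m) f
      ≡⟨ L-suc (suc j) m f ⟩
    sumTo (suc b) (λ a → divPow (suc j) a * L (suc (suc j)) m (λ w s → f (suc j ℕ.* a ℕ.+ w) (a ℕ.+ s)))
      ≡⟨ sumTo-suc b _ ⟩
    divPow (suc j) 0 * L (suc (suc j)) m (λ w s → f (suc j ℕ.* 0 ℕ.+ w) s) +
    sumTo b (λ a → divPow (suc j) (suc a) * L (suc (suc j)) m (λ w s → f (suc j ℕ.* suc a ℕ.+ w) (suc a ℕ.+ s)))
      ≈⟨ +-cong
           (*-cong (trans (*-identityˡ _) inv!-zero)
             (trans (L-cong (suc (suc j)) m (λ w s → reflexive (≡.cong (λ i → f (i ℕ.+ w) s) (ℕₚ.*-zeroʳ j))))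
                    (L-origin (suc j) m f f≈0)))
           (sumTo-zero b (λ a → trans (*-congˡ (L-zero (suc (suc j)) m (λ w s → f≈0 _ _))) (zeroʳ _))) ⟩
    1# * f 0 0 + 0#
      ≈⟨ trans (+-identityʳ _) (*-identityˡ _) ⟩
    f 0 0 ∎

  v^₀≈1 : ∀ k → (v ^ k) 0 ≈ 1#
  v^₀≈1 zero    = refl
  v^₀≈1 (suc k) = trans (*-cong (v₀≈1 γ₀≈0) (v^₀≈1 k)) (*-identityˡ _)

  -- The multinomial expansion of (1 - γ)^-(r+2), scaled by (r + 1)!. It is obtained by matching
  -- `L-by-parts` with `v^-recurrence`, by strong induction on `n`. The bound `n ≤ m` brings in all
  -- variables of index up to `n`; `n ≤ b` gives the support condition of `L-by-parts`.
  tuple-coefficient : ∀ r m n → n ℕ.≤ m → n ℕ.≤ b →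
    L 1 m (λ w s → at n w (((s ℕ.+ suc r) !) × 1#)) ≈ (suc r !) × (v ^ suc (suc r)) n
  tuple-coefficient r m n n≤m n≤b = below (suc n) n ℕₚ.≤-refl n≤m n≤b
    where
    H : Series
    H = v ^ suc (suc r)
    below : ∀ N n → n ℕ.< N → n ℕ.≤ m → n ℕ.≤ b →
      L 1 m (λ w s → at n w (((s ℕ.+ suc r) !) × 1#)) ≈ (suc r !) × H n
    below (suc N) zero _ _ _ = begin
      L 1 m (λ w s → at 0 w (((s ℕ.+ suc r) !) × 1#))
        ≈⟨ L-origin 0 m _ (λ w s → refl) ⟩
      (suc r !) × 1#
        ≈⟨ ×-congʳ (suc r !) (v^₀≈1 (suc (suc r))) ⟨
      (suc r !) × H 0 ∎
    below (suc N) (suc n) n<N n≤m n≤b = ×-cancelˡ n (begin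
      N′ × L 1 m (λ w s → at N′ w (((s ℕ.+ suc r) !) × 1#))
        ≈⟨ L-× 1 m N′ _ ⟨
      L 1 m (λ w s → N′ × at N′ w (((s ℕ.+ suc r) !) × 1#))
        ≈⟨ L-cong 1 m split ⟩
      L 1 m (λ w s → (suc r ℕ.* w ℕ.+ N′ ℕ.* s) × g w s)
        ≈⟨ L-by-parts (suc r) N′ m 0 g (λ w s b<w →
             reflexive (at-≢ _ λ w≡ → ℕₚ.<-irrefl (≡.sym w≡) (ℕₚ.≤-<-trans n≤b b<w))) ⟩
      sumTo m (λ i → ((suc r ℕ.* suc i ℕ.+ N′) × γ (suc i)) * e (suc i))
        ≈⟨ sumTo-cong m (λ i → *-congʳ (×-congˡ (ℕₚ.+-comm (suc r ℕ.* suc i) N′))) ⟩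
      sumTo m (λ i → A (suc i) * e (suc i))
        ≈⟨ sumTo-∗ m n (tail A) ((suc r !) SM.× H) (e ∘ suc) n≤m e≈H e≈0 ⟩
      (tail A ∗ ((suc r !) SM.× H)) n
        -- `A 0` is a multiple of `γ 0`, hence zero, so the convolution may start at index 0.
        ≈⟨ trans (+-congʳ (*-nullˡ _ (trans (×-congʳ (N′ ℕ.+ suc r ℕ.* 0) γ₀≈0) (×-zeroʳ (N′ ℕ.+ suc r ℕ.* 0))))) (+-identityˡ _) ⟨
      (A ∗ ((suc r !) SM.× H)) N′
        ≈⟨ SM.×-comm-* (suc r !) A H N′ ⟩
      ((suc r !) SM.× (A ∗ H)) N′
        ≈⟨ ×-coefficient (suc r !) (A ∗ H) N′ ⟩
      (suc r !) × (A ∗ H) N′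
        ≈⟨ ×-congʳ (suc r !) (v^-recurrence (suc r) N′) ⟨
      (suc r !) × (N′ × H N′)
        ≈⟨ trans (×-assocˡ (H N′) (suc r !) N′)
             (trans (×-congˡ (ℕₚ.*-comm (suc r !) N′)) (sym (×-assocˡ (H N′) N′ (suc r !)))) ⟩
      N′ × ((suc r !) × H N′) ∎)
      where
      N′ : ℕ
      N′ = suc n
      -- The factorial is one lower than in the goal: `L-by-parts` replaces `s` by `suc s` and so
      -- restores it.
      g : ℕ → ℕ → Carrier
      g w s = at N′ w (((s ℕ.+ r) !) × 1#)
      e A : Series
      e i = L 1 m (λ w s → g (i ℕ.+ w) (suc s))
      A i = (N′ ℕ.+ suc r ℕ.* i) × γ i
      -- When `w` is `N′`, the factor N′·(s + r + 1) equals (r + 1)·w + N′·s, a linear form in `w`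
      -- and `s` as required by `L-by-parts`.
      split : ∀ w s → N′ × at N′ w (((s ℕ.+ suc r) !) × 1#) ≈ (suc r ℕ.* w ℕ.+ N′ ℕ.* s) × g w s
      split w s with w ℕₚ.≟ N′
      ... | yes ≡.refl = begin
        w × at w w (((s ℕ.+ suc r) !) × 1#)
          ≡⟨ ≡.cong (w ×_) (at-≡ {w} _ ≡.refl) ⟩
        w × (((s ℕ.+ suc r) !) × 1#)
          ≈⟨ ×-assocˡ 1# w ((s ℕ.+ suc r) !) ⟩
        (w ℕ.* ((s ℕ.+ suc r) !)) × 1#
          ≡⟨ ≡.cong (_× 1#) factorial ⟩
        ((suc r ℕ.* w ℕ.+ w ℕ.* s) ℕ.* ((s ℕ.+ r) !)) × 1#
          ≈⟨ ×-assocˡ 1# (suc r ℕ.* w ℕ.+ w ℕ.* s) ((s ℕ.+ r) !) ⟨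
        (suc r ℕ.* w ℕ.+ w ℕ.* s) × (((s ℕ.+ r) !) × 1#)
          ≡⟨ ≡.cong ((suc r ℕ.* w ℕ.+ w ℕ.* s) ×_) (at-≡ {w} _ ≡.refl) ⟨
        (suc r ℕ.* w ℕ.+ w ℕ.* s) × g w s ∎
        where
        factorial : w ℕ.* ((s ℕ.+ suc r) !) ≡ (suc r ℕ.* w ℕ.+ w ℕ.* s) ℕ.* ((s ℕ.+ r) !)
        factorial = ≡.trans (≡.cong (λ i → w ℕ.* (i !)) (ℕₚ.+-suc s r))
          (ℕSolver.+-*-Solver.solve 4
            (λ w s r p → w :*ₙ ((con 1 :+ₙ (s :+ₙ r)) :*ₙ p) :=ₙ ((con 1 :+ₙ r) :*ₙ w :+ₙ w :*ₙ s) :*ₙ p)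
            ≡.refl w s r ((s ℕ.+ r) !))
          where
          open ℕSolver.+-*-Solver using (con) renaming (_:+_ to _:+ₙ_; _:*_ to _:*ₙ_; _:=_ to _:=ₙ_)
      ... | no w≢ = begin
        N′ × at N′ w _                                   ≡⟨ ≡.cong (N′ ×_) (at-≢ _ w≢) ⟩
        N′ × 0#                                          ≈⟨ ×-zeroʳ N′ ⟩
        0#                                               ≈⟨ ×-zeroʳ (suc r ℕ.* w ℕ.+ N′ ℕ.* s) ⟨
        (suc r ℕ.* w ℕ.+ N′ ℕ.* s) × 0#
          ≡⟨ ≡.cong ((suc r ℕ.* w ℕ.+ N′ ℕ.* s) ×_) (at-≢ _ w≢) ⟨
        (suc r ℕ.* w ℕ.+ N′ ℕ.* s) × g w s               ∎
      e≈H : ∀ i k → i ℕ.+ k ≡ n → e (suc i) ≈ ((suc r !) SM.× H) k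
      e≈H i k p = begin
        L 1 m (λ w s → at N′ (suc i ℕ.+ w) (((suc s ℕ.+ r) !) × 1#))
          ≈⟨ L-cong 1 m (λ w s → reflexive (≡.trans (at-shift (suc i) w _ (≡.cong suc p))
               (≡.cong (λ t → at k w ((t !) × 1#)) (≡.sym (ℕₚ.+-suc s r))))) ⟩
        L 1 m (λ w s → at k w (((s ℕ.+ suc r) !) × 1#))
          ≈⟨ below N k (ℕₚ.<-≤-trans (ℕ.s≤s k≤n) (ℕₚ.≤-pred n<N)) (ℕₚ.≤-trans k≤N′ n≤m) (ℕₚ.≤-trans k≤N′ n≤b) ⟩
        (suc r !) × H k
          ≈⟨ ×-coefficient (suc r !) H k ⟨
        ((suc r !) SM.× H) k ∎
        where
        k≤n : k ℕ.≤ n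
        k≤n = ≡.subst (k ℕ.≤_) p (ℕₚ.m≤n+m k i)
        k≤N′ : k ℕ.≤ N′
        k≤N′ = ℕₚ.m≤n⇒m≤1+n k≤n
      e≈0 : ∀ i → n ℕ.< i → e (suc i) ≈ 0#
      e≈0 i n<i = L-zero 1 m (λ w s → reflexive (at-≢ _ (λ p →
        ℕₚ.<-irrefl (≡.sym p) (ℕ.s≤s (ℕₚ.<-≤-trans n<i (ℕₚ.m≤m+n i w))))))

-- The substitution x ↦ -x and the involution.

module SignTwist {c ℓ} (R : CommutativeRing c ℓ)
  (ε : CommutativeRing.Carrier R) where
  open CommutativeRing R
  open Exp semiring
  open Series R
  open Derivation R using (module S) renaming (_^_ to _^ˢ_)
  open NaturalSolver commutativeSemiring using (solve; _:+_; _:*_; _:=_)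
  open SetoidReasoning setoid

  -- The substitution x ↦ ε·x, hence a ring endomorphism of series.
  twist : Series → Series
  twist a n = ε ^ n * a n

  twist-cong : ∀ {a b} → a S.≈ b → twist a S.≈ twist b
  twist-cong p n = *-congˡ (p n)

  twist-1s : twist 1s S.≈ 1s
  twist-1s zero    = *-identityˡ _
  twist-1s (suc n) = zeroʳ _

  twist-∗ : ∀ a b → twist (a ∗ b) S.≈ twist a ∗ twist b
  twist-∗ a b zero    = trans
    (solve 3 (λ o x y → o :* (x :* y) := x :* (o :* y)) refl 1# (a 0) (b 0))
    (*-congʳ (sym (*-identityˡ _)))
  twist-∗ a b (suc n) = begin
    ε * ε ^ n * (a 0 * b (suc n) + (tail a ∗ b) n)
      ≈⟨ expand ε (ε ^ n) (a 0) (b (suc n)) _ ⟩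
    a 0 * (ε * ε ^ n * b (suc n)) + ε * (ε ^ n * (tail a ∗ b) n)
      ≈⟨ +-cong (*-congʳ (sym (*-identityˡ _))) (*-congˡ (twist-∗ (tail a) b n)) ⟩
    -- The outer `ε` moves into the left factor because `tail (twist a)` is `ε` times
    -- `twist (tail a)`.
    twist a 0 * twist b (suc n) + ε * (twist (tail a) ∗ twist b) n
      ≈⟨ +-congˡ (begin
           ε * (twist (tail a) ∗ twist b) n          ≈⟨ *-congˡ (∗-comm (twist (tail a)) (twist b) n) ⟩
           ε * (twist b ∗ twist (tail a)) n          ≈⟨ ∗-scale (twist b) ε (twist (tail a)) n ⟨
           (twist b ∗ λ i → ε * twist (tail a) i) n
             ≈⟨ S.*-congˡ {twist b} (λ i → sym (*-assoc ε (ε ^ i) (a (suc i)))) n ⟩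
           (twist b ∗ tail (twist a)) n              ≈⟨ ∗-comm (twist b) (tail (twist a)) n ⟩
           (tail (twist a) ∗ twist b) n              ∎) ⟩
    (twist a ∗ twist b) (suc n) ∎
    where
    expand : ∀ e p x y z → e * p * (x * y + z) ≈ x * (e * p * y) + e * (p * z)
    expand = solve 5 (λ e p x y z → e :* p :* (x :* y :+ z) := x :* (e :* p :* y) :+ e :* (p :* z)) refl

  twist-^ : ∀ a k → twist (a ^ˢ k) S.≈ twist a ^ˢ k
  twist-^ a zero    = twist-1s
  twist-^ a (suc k) = S.trans (twist-∗ a (a ^ˢ k)) (S.*-congˡ {twist a} (twist-^ a k))

module Involution {c ℓ} (R : CommutativeRing c ℓ)
  (×-cancelˡ : Series.TorsionFree R) where
  open CommutativeRing R
  open Mult semiring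
  open Exp semiring
  open Series R
  open Derivation R renaming (_^_ to _^ˢ_)
  open RingProperties ring using (-1*x≈-x; -‿involutive)
  open SetoidReasoning setoid

  ε : Carrier
  ε = - 1#

  open SignTwist R ε

  ε*ε≈1 : ε * ε ≈ 1#
  ε*ε≈1 = trans (-1*x≈-x ε) (-‿involutive 1#)

  ε^*ε^≈1 : ∀ n → ε ^ n * ε ^ n ≈ 1#
  ε^*ε^≈1 n = ^-inverse ε ε n ε*ε≈1
    where
    open Powers R using (^-inverse)

  LagrangeRelated : (γ v α : Series) → Set ℓ
  LagrangeRelated γ v α = ∀ n → let m = suc n in
    suc m × α m ≈ ε ^ suc m * (v ^ˢ suc m) m

  -- The twist x ↦ −x turns 1 − Σ αₙ xⁿ into G.
  involution : ∀ γ v α w → γ 0 ≈ 0# → α 0 ≈ 0# →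
    v S.≈ 1s S.+ γ ∗ v → w S.≈ 1s S.+ α ∗ w →
    LagrangeRelated γ v α → LagrangeRelated α w γ
  involution γ v α w γ₀≈0 α₀≈0 v-fix w-fix α-related n = begin
    suc m × γ m
      ≈⟨ +-inverseʳ-unique _ _ (lagrange G (twist w) G-coefficient G∗w≈1 n) ⟩
    - (twist w ^ˢ suc m) m
      ≈⟨ -‿cong (twist-^ w (suc m) m) ⟨
    - (ε ^ m * (w ^ˢ suc m) m)
      ≈⟨ trans (sym (-1*x≈-x _)) (sym (*-assoc _ _ _)) ⟩
    ε ^ suc m * (w ^ˢ suc m) m ∎
    where
    open RingProperties ring using (+-inverseʳ-unique; -0#≈0#)
    open LagrangeInversion R ×-cancelˡ γ v γ₀≈0 v-fix using (lagrange)
    m : ℕ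
    m = suc n
    G : Series
    G = twist (1s S.- α)
    G∗w≈1 : G ∗ twist w S.≈ 1s
    G∗w≈1 = S.trans (S.sym (twist-∗ (1s S.- α) w))
      (S.trans (twist-cong (GeometricInverse.u∗v α w w-fix)) twist-1s)
    G-coefficient : ∀ k → suc k × G k ≈ (v ^ˢ suc k) k
    -- `LagrangeRelated` starts at index 1, so degree 0 is read off the constant terms.
    G-coefficient zero = begin
      1# * (1# - α 0) + 0#    ≈⟨ trans (+-identityʳ _) (*-identityˡ _) ⟩
      1# - α 0                ≈⟨ +-congˡ (trans (-‿cong α₀≈0) -0#≈0#) ⟩
      1# + 0#                 ≈⟨ +-identityʳ _ ⟩
      1#                      ≈⟨ trans (*-identityʳ _) (GeometricInverse.v₀≈1 γ v v-fix γ₀≈0) ⟨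
      v 0 * 1#                ∎
    -- The twist contributes `ε ^ j` and the minus sign before `α` one more `ε`; together they
    -- cancel the sign in `α-related`.
    G-coefficient (suc k) = begin
      suc j × (ε ^ j * (0# - α j))
        ≈⟨ ×-congʳ (suc j) (*-congˡ (trans (+-identityˡ _) (sym (-1*x≈-x _)))) ⟩
      suc j × (ε ^ j * (ε * α j))
        ≈⟨ ×-congʳ (suc j) (trans (sym (*-assoc _ _ _)) (*-congʳ (*-comm _ _))) ⟩
      suc j × (ε ^ suc j * α j)
        ≈⟨ ×-comm-* (suc j) _ _ ⟨
      ε ^ suc j * (suc j × α j)
        ≈⟨ *-congˡ (α-related k) ⟩
      ε ^ suc j * (ε ^ suc j * (v ^ˢ suc j) j)
        ≈⟨ *-assoc _ _ _ ⟨
      ε ^ suc j * ε ^ suc j * (v ^ˢ suc j) j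
        ≈⟨ trans (*-congʳ (ε^*ε^≈1 (suc j))) (*-identityˡ _) ⟩
      (v ^ˢ suc j) j ∎
      where
      j : ℕ
      j = suc k

-- From sums over lists of tuples to iterated sums.

module TupleListSums {c ℓ} (R : CommutativeRing c ℓ)
  (inv! : Series.Series R) (inv!-laws : Series.ReciprocalFactorials R inv!)
  (γ : Series.Series R) where
  open CommutativeRing R
  open Series R
  open ReciprocalFactorials inv!-laws
  open RawSemiringDefinitions (Semiring.rawSemiring semiring) using (_^_; product)
  open RangeSums R
  open NaturalSolver commutativeSemiring using (solve; _:*_; _:=_)
  open SetoidReasoning setoid

  -- The same fold as `∑`, so over the complex numbers the two agree by definition.
  sumL : ∀ {A : Set} → List A → (A → Carrier) → Carrier
  sumL xs f = List.foldr (λ x s → f x + s) 0# xs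

  sumL-cong : ∀ {A : Set} (xs : List A) {f g} → (∀ x → f x ≈ g x) → sumL xs f ≈ sumL xs g
  sumL-cong []       p = refl
  sumL-cong (x ∷ xs) p = +-cong (p x) (sumL-cong xs p)

  sumL-* : ∀ {A : Set} (xs : List A) z (f : A → Carrier) → sumL xs (λ x → z * f x) ≈ z * sumL xs f
  sumL-* []       z f = sym (zeroʳ z)
  sumL-* (x ∷ xs) z f = trans (+-congˡ (sumL-* xs z f)) (sym (distribˡ _ _ _))

  sumL-++ : ∀ {A : Set} (xs ys : List A) (f : A → Carrier) → sumL (xs List.++ ys) f ≈ sumL xs f + sumL ys f
  sumL-++ []       ys f = sym (+-identityˡ _)
  sumL-++ (x ∷ xs) ys f = trans (+-congˡ (sumL-++ xs ys f)) (sym (+-assoc _ _ _))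

  sumL-map : ∀ {A B : Set} (h : A → B) xs (f : B → Carrier) → sumL (List.map h xs) f ≡ sumL xs (f ∘ h)
  sumL-map h []       f = ≡.refl
  sumL-map h (x ∷ xs) f = ≡.cong (f (h x) +_) (sumL-map h xs f)

  sumL-cartesianProductWith : ∀ {A B C : Set} (h : A → B → C) xs ys (f : C → Carrier) →
    sumL (List.cartesianProductWith h xs ys) f ≈ sumL xs (λ x → sumL ys (λ y → f (h x y)))
  sumL-cartesianProductWith h []       ys f = refl
  sumL-cartesianProductWith h (x ∷ xs) ys f = trans (sumL-++ (List.map (h x) ys) _ f)
    (+-cong (reflexive (sumL-map (h x) ys f)) (sumL-cartesianProductWith h xs ys f))

  sumL-filter : ∀ {A : Set} {P : A → Set} (P? : ∀ x → Dec (P x)) xs (f : A → Carrier) →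
    sumL (List.filter P? xs) f ≈ sumL xs (λ x → if does (P? x) then f x else 0#)
  sumL-filter P? []       f = refl
  sumL-filter P? (x ∷ xs) f with does (P? x)
  ... | true  = +-congˡ (sumL-filter P? xs f)
  ... | false = trans (sumL-filter P? xs f) (sym (+-identityˡ _))

  sumL-applyUpTo : ∀ (h : ℕ → ℕ) n (f : ℕ → Carrier) → sumL (List.applyUpTo h n) f ≈ sumTo n (f ∘ h)
  sumL-applyUpTo h zero    f = reflexive (≡.sym (sumTo-empty (f ∘ h)))
  sumL-applyUpTo h (suc n) f = trans (+-congˡ (sumL-applyUpTo (h ∘ suc) n f)) (reflexive (≡.sym (sumTo-suc n (f ∘ h))))

  -- The starting index varies so that removing the first exponent stays within the family; at `j` =
  -- 1 it is the product in `monomial`.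
  monomialFrom : ℕ → ∀ {m} → Vec ℕ m → Carrier
  monomialFrom j k = product (λ i → γ (j ℕ.+ toℕ i) ^ lookup k i)

  product-cong : ∀ m {f g : Fin m → Carrier} → (∀ i → f i ≡ g i) → product f ≡ product g
  product-cong zero    p = ≡.refl
  product-cong (suc m) p = ≡.cong₂ _*_ (p Fin.zero) (product-cong m (p ∘ Fin.suc))

  monomialFrom-∷ : ∀ j {m} a (k : Vec ℕ m) → monomialFrom j (a ∷ k) ≡ γ j ^ a * monomialFrom (suc j) k
  monomialFrom-∷ j {m} a k = ≡.cong₂ _*_ (≡.cong (λ i → γ i ^ a) (ℕₚ.+-identityʳ j))
    (product-cong m (λ i → ≡.cong (λ n → γ n ^ lookup k i) (ℕₚ.+-suc j (toℕ i))))

  inv∏! : ∀ {m} → Vec ℕ m → Carrier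
  inv∏! []      = 1#
  inv∏! (a ∷ k) = inv! a * inv∏! k

  module _ (b : ℕ) where
    open TupleSums R inv! inv!-laws γ b

    -- Both sides recurse on the first exponent: the Cartesian product of lists becomes the outer
    -- sum of `L`.
    sumL-boundedTuples : ∀ m j (f : ℕ → ℕ → Carrier) →
      sumL (boundedTuples m b) (λ k → monomialFrom j k * inv∏! k * f (weightFrom j k) (Vec.sum k)) ≈ L j m f
    sumL-boundedTuples zero    j f = begin
      1# * 1# * f 0 0 + 0#
        ≈⟨ trans (+-identityʳ _) (trans (*-congʳ (*-identityˡ _)) (*-identityˡ _)) ⟩
      f 0 0                   ≡⟨ L-zero-variables j f ⟨
      L j 0 f                 ∎
    sumL-boundedTuples (suc m) j f = begin
      sumL (boundedTuples (suc m) b) (λ k → monomialFrom j k * inv∏! k * f (weightFrom j k) (Vec.sum k))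
        ≈⟨ sumL-cartesianProductWith _∷_ (upTo (suc b)) (boundedTuples m b) _ ⟩
      sumL (upTo (suc b)) (λ a → sumL (boundedTuples m b) (term a))
        ≈⟨ sumL-applyUpTo (λ a → a) (suc b) _ ⟩
      sumTo (suc b) (λ a → sumL (boundedTuples m b) (term a))
        ≈⟨ sumTo-cong (suc b) (λ a → trans (sumL-cong (boundedTuples m b) (factor a))
             (trans (sumL-* (boundedTuples m b) (divPow j a) _) (*-congˡ (sumL-boundedTuples m (suc j) _)))) ⟩
      sumTo (suc b) (λ a → divPow j a * L (suc j) m (λ w s → f (j ℕ.* a ℕ.+ w) (a ℕ.+ s)))
        ≡⟨ L-suc j m f ⟨
      L j (suc m) f ∎
      where
      term : ℕ → Vec ℕ m → Carrier
      term a k = monomialFrom j (a ∷ k) * (inv! a * inv∏! k) * f (j ℕ.* a ℕ.+ weightFrom (suc j) k) (a ℕ.+ Vec.sum k)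
      factor : ∀ a k → term a k ≈ divPow j a *
        (monomialFrom (suc j) k * inv∏! k * f (j ℕ.* a ℕ.+ weightFrom (suc j) k) (a ℕ.+ Vec.sum k))
      factor a k = trans (*-congʳ (*-congʳ (reflexive (monomialFrom-∷ j a k))))
        (solve 5 (λ p q r s t → (p :* q) :* (r :* s) :* t := (p :* r) :* (q :* s :* t)) refl _ _ _ _ _)

module ExplicitSum {c ℓ} (R : CommutativeRing c ℓ)
  (×-cancelˡ : Series.TorsionFree R)
  (inv! : Series.Series R) (inv!-laws : Series.ReciprocalFactorials R inv!)
  (γ v : Series.Series R) (γ₀≈0 : Series.ZeroConstant R γ) (v-fix : Series.Geometric R γ v)
  where
  open CommutativeRing R
  open Mult semiring
  open Series R
  open Derivation R using (_^_)
  open TupleListSums R inv! inv!-laws γ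
  open SetoidReasoning setoid

  -- One `n` serves as number of variables, bound on the exponents, weight and factorial offset;
  -- writing it as `suc r` fits `tuple-coefficient`.
  sumL-tuples : ∀ r → let n = suc r in (coefficient : Vec ℕ n → Carrier) →
    (∀ k → coefficient k ≈ (((Vec.sum k ℕ.+ n) !) × 1#) * inv∏! k) →
    sumL (tuples n) (λ k → coefficient k * monomialFrom 1 k) ≈ (n !) × (v ^ suc n) n
  sumL-tuples r coefficient coefficient≈ = begin
    sumL (tuples n) (λ k → coefficient k * monomialFrom 1 k)
      ≈⟨ sumL-filter (λ k → weight k ℕₚ.≟ n) (boundedTuples n n) _ ⟩
    sumL (boundedTuples n n) (λ k → if weight k ℕ.≡ᵇ n then coefficient k * monomialFrom 1 k else 0#)
      ≈⟨ sumL-cong (boundedTuples n n) restrict ⟩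
    sumL (boundedTuples n n) (λ k → monomialFrom 1 k * inv∏! k * at n (weight k) (((Vec.sum k ℕ.+ n) !) × 1#))
      ≈⟨ sumL-boundedTuples n n 1 (λ w s → at n w (((s ℕ.+ n) !) × 1#)) ⟩
    L 1 n (λ w s → at n w (((s ℕ.+ n) !) × 1#))
      ≈⟨ tuple-coefficient r n n ℕₚ.≤-refl ℕₚ.≤-refl ⟩
    (n !) × (v ^ suc n) n ∎
    where
    n : ℕ
    n = suc r
    open TupleCoefficients R ×-cancelˡ inv! inv!-laws γ v γ₀≈0 v-fix n
    open TupleSums R inv! inv!-laws γ n using (L)
    restrict : ∀ k → (if weight k ℕ.≡ᵇ n then coefficient k * monomialFrom 1 k else 0#) ≈
      monomialFrom 1 k * inv∏! k * at n (weight k) (((Vec.sum k ℕ.+ n) !) × 1#)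
    restrict k with weight k ℕ.≡ᵇ n
    ... | true  = trans (*-congʳ (coefficient≈ k)) (trans (*-comm _ _)
                    (trans (*-congˡ (*-comm _ _)) (sym (*-assoc _ _ _))))
    ... | false = sym (zeroʳ _)

open import Defs

-- Rational arithmetic in the complex numbers and the inversion of the transform.

module ℂ-Arithmetic where
  open CommutativeRing ℂ-commutativeRing hiding (_≈_; _+_; _*_; 0#)
  open Mult semiring
  open SetoidReasoning setoid

  fromℚ-* : ∀ p q → fromℚ (p ℚ.* q) ≈ fromℚ p * fromℚ q
  fromℚ-* p q = mk≈ᶜ
    (≗⇒≈ λ _ → ≡.sym (ℚₚ.+-identityʳ (p ℚ.* q)))
    (≗⇒≈ λ _ → ≡.sym (≡.trans (≡.cong₂ ℚ._+_ (ℚₚ.*-zeroʳ p) (ℚₚ.*-zeroˡ q)) (ℚₚ.+-identityʳ ℚ.0ℚ)))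

  fromℚ-+ : ∀ p q → fromℚ (p ℚ.+ q) ≈ fromℚ p + fromℚ q
  fromℚ-+ p q = mk≈ᶜ (≗⇒≈ λ _ → ≡.refl) (≗⇒≈ λ _ → ≡.refl)

  -- Division normalises by the gcd, so identities between fractions are checked on unnormalised
  -- representatives by cross multiplication and carried back through this homomorphism.
  fromℚᵘ-* : ∀ p q → ℚ.fromℚᵘ (p ℚᵘ.* q) ≡ ℚ.fromℚᵘ p ℚ.* ℚ.fromℚᵘ q
  fromℚᵘ-* p q = ℚₚ.toℚᵘ-injective (ℚᵘₚ.≃-trans (ℚₚ.toℚᵘ-fromℚᵘ (p ℚᵘ.* q)) (ℚᵘₚ.≃-sym
    (ℚᵘₚ.≃-trans (ℚₚ.toℚᵘ-homo-* (ℚ.fromℚᵘ p) (ℚ.fromℚᵘ q))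
      (ℚᵘₚ.*-cong (ℚₚ.toℚᵘ-fromℚᵘ p) (ℚₚ.toℚᵘ-fromℚᵘ q)))))

  fromℚᵘ-+ : ∀ p q → ℚ.fromℚᵘ (p ℚᵘ.+ q) ≡ ℚ.fromℚᵘ p ℚ.+ ℚ.fromℚᵘ q
  fromℚᵘ-+ p q = ℚₚ.toℚᵘ-injective (ℚᵘₚ.≃-trans (ℚₚ.toℚᵘ-fromℚᵘ (p ℚᵘ.+ q)) (ℚᵘₚ.≃-sym
    (ℚᵘₚ.≃-trans (ℚₚ.toℚᵘ-homo-+ (ℚ.fromℚᵘ p) (ℚ.fromℚᵘ q))
      (ℚᵘₚ.+-cong (ℚₚ.toℚᵘ-fromℚᵘ p) (ℚₚ.toℚᵘ-fromℚᵘ q)))))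

  fromℤ : ℤ → ℂ
  fromℤ i = fromℚ (i ℚ./ 1)

  fromℤ-* : ∀ i j → fromℤ (i ℤ.* j) ≈ fromℤ i * fromℤ j
  fromℤ-* i j = trans (reflexive (≡.cong fromℚ (fromℚᵘ-* (ℚᵘ.mkℚᵘ i 0) (ℚᵘ.mkℚᵘ j 0)))) (fromℚ-* (i ℚ./ 1) (j ℚ./ 1))

  fromℕ≈× : ∀ n → fromℤ (ℤ.+ n) ≈ n × 1#
  fromℕ≈× zero    = refl
  fromℕ≈× (suc n) = begin
    fromℤ (ℤ.+ suc n)
      ≡⟨ ≡.cong fromℚ (ℚₚ.fromℚᵘ-cong {ℚᵘ.mkℚᵘ (ℤ.+ suc n) 0}
           {ℚᵘ.mkℚᵘ (ℤ.+ 1) 0 ℚᵘ.+ ℚᵘ.mkℚᵘ (ℤ.+ n) 0} (ℚᵘ.*≡* (≡.cong (ℤ._* ℤ.+ 1) unit))) ⟩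
    fromℚ (ℚ.fromℚᵘ (ℚᵘ.mkℚᵘ (ℤ.+ 1) 0 ℚᵘ.+ ℚᵘ.mkℚᵘ (ℤ.+ n) 0))
      ≡⟨ ≡.cong fromℚ (fromℚᵘ-+ (ℚᵘ.mkℚᵘ (ℤ.+ 1) 0) (ℚᵘ.mkℚᵘ (ℤ.+ n) 0)) ⟩
    fromℚ (ℚ.1ℚ ℚ.+ (ℤ.+ n) ℚ./ 1)                 ≈⟨ fromℚ-+ ℚ.1ℚ (ℤ.+ n ℚ./ 1) ⟩
    1# + fromℤ (ℤ.+ n)                             ≈⟨ +-congˡ (fromℕ≈× n) ⟩
    suc n × 1#                                     ∎
    where
    unit : ℤ.+ suc n ≡ ℤ.+ 1 ℤ.* ℤ.+ 1 ℤ.+ ℤ.+ n ℤ.* ℤ.+ 1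
    unit = ≡.cong (λ i → ℤ.+ 1 ℤ.+ i) (≡.sym (ℤₚ.*-identityʳ (ℤ.+ n)))

  ×-/ : ∀ i d .{{_ : NonZero d}} → d × fromℚ (i ℚ./ d) ≈ fromℤ i
  ×-/ i (suc d) = begin
    suc d × fromℚ (i ℚ./ suc d)                    ≈⟨ ×-congʳ (suc d) (*-identityˡ _) ⟨
    suc d × (1# * fromℚ (i ℚ./ suc d))             ≈⟨ ×-assoc-* (suc d) 1# _ ⟨
    (suc d × 1#) * fromℚ (i ℚ./ suc d)             ≈⟨ *-congʳ (fromℕ≈× (suc d)) ⟨
    fromℤ (ℤ.+ suc d) * fromℚ (i ℚ./ suc d)        ≈⟨ fromℚ-* (ℤ.+ suc d ℚ./ 1) (i ℚ./ suc d) ⟨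
    fromℚ ((ℤ.+ suc d ℚ./ 1) ℚ.* (i ℚ./ suc d))
      ≡⟨ ≡.cong fromℚ (fromℚᵘ-* (ℚᵘ.mkℚᵘ (ℤ.+ suc d) 0) (ℚᵘ.mkℚᵘ i d)) ⟨
    fromℚ (ℚ.fromℚᵘ (ℚᵘ.mkℚᵘ (ℤ.+ suc d) 0 ℚᵘ.* ℚᵘ.mkℚᵘ i d))
      ≡⟨ ≡.cong fromℚ (ℚₚ.fromℚᵘ-cong {ℚᵘ.mkℚᵘ (ℤ.+ suc d) 0 ℚᵘ.* ℚᵘ.mkℚᵘ i d} {ℚᵘ.mkℚᵘ i 0} (ℚᵘ.*≡* cross)) ⟩
    fromℤ i ∎
    where
    cross : (ℤ.+ suc d ℤ.* i) ℤ.* ℤ.+ 1 ≡ i ℤ.* ℤ.+ suc (d ℕ.+ 0)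
    cross = ≡.trans (ℤₚ.*-identityʳ _) (≡.trans (ℤₚ.*-comm (ℤ.+ suc d) i)
      (≡.cong (λ e → i ℤ.* ℤ.+ suc e) (≡.sym (ℕₚ.+-identityʳ d))))

  -- Multiplying by 1/d undoes `d ×_`; this supplies `TorsionFree`.
  ×-cancel : ∀ d .{{_ : NonZero d}} {x y} → d × x ≈ d × y → x ≈ y
  ×-cancel d {x} {y} p = trans (sym (recover x)) (trans (*-congˡ p) (recover y))
    where
    recover : ∀ z → fromℚ (ℤ.+ 1 ℚ./ d) * (d × z) ≈ z
    recover z = begin
      fromℚ (ℤ.+ 1 ℚ./ d) * (d × z)   ≈⟨ ×-comm-* d _ z ⟩
      d × (fromℚ (ℤ.+ 1 ℚ./ d) * z)   ≈⟨ ×-assoc-* d _ z ⟨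
      (d × fromℚ (ℤ.+ 1 ℚ./ d)) * z   ≈⟨ *-congʳ (×-/ (ℤ.+ 1) d) ⟩
      1# * z                          ≈⟨ *-identityˡ z ⟩
      z                               ∎

  inv! : ℕ → ℂ
  inv! n = fromℚ ((ℤ.+ 1 ℚ./ (n !)) {{n ℕₚ.!≢0}})

  ×-inv! : ∀ n → (n !) × inv! n ≈ 1#
  ×-inv! n = ×-/ (ℤ.+ 1) (n !) {{n ℕₚ.!≢0}}

  inv!-suc : ∀ n → suc n × inv! (suc n) ≈ inv! n
  inv!-suc n = ×-cancel (n !) {{n ℕₚ.!≢0}} (begin
    (n !) × (suc n × inv! (suc n))     ≈⟨ ×-assocˡ _ (n !) (suc n) ⟩
    ((n !) ℕ.* suc n) × inv! (suc n)   ≡⟨ ≡.cong (_× inv! (suc n)) (ℕₚ.*-comm (n !) (suc n)) ⟩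
    (suc n !) × inv! (suc n)           ≈⟨ ×-inv! (suc n) ⟩
    1#                                 ≈⟨ ×-inv! n ⟨
    (n !) × inv! n                     ∎)


  inv!-laws : Series.ReciprocalFactorials ℂ-commutativeRing inv!
  inv!-laws = record { inv!-zero = refl ; inv!-suc = inv!-suc }

  ε : ℂ
  ε = - 1#

  sign : ∀ n → fromℤ (-1ℤ ℤ.^ n) ≈ ε ^ n
  sign zero    = refl
  sign (suc n) = trans (fromℤ-* -1ℤ (-1ℤ ℤ.^ n)) (*-cong (mk≈ᶜ (≗⇒≈ λ _ → ≡.refl) (≗⇒≈ λ _ → ≡.refl)) (sign n))

  -- Meets `ZeroConstant` by `refl`; `transform` reads its sequence at positive indices, where the
  -- two agree.
  dropConstant : (ℕ → ℂ) → ℕ → ℂ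
  dropConstant γ zero    = 0#
  dropConstant γ (suc n) = γ (suc n)

  module _ (γ : ℕ → ℂ) where
    open GeometricSeries ℂ-commutativeRing (dropConstant γ) refl public
    open TupleListSums ℂ-commutativeRing inv! inv!-laws (dropConstant γ) using (inv∏!)
    open Derivation ℂ-commutativeRing using () renaming (_^_ to _^ˢ_)

    ×-inv∏! : ∀ {m} (k : Vec ℕ m) → ∏! k × inv∏! k ≈ 1#
    ×-inv∏! []      = +-identityʳ 1#
    ×-inv∏! (a ∷ k) = begin
      ((a !) ℕ.* ∏! k) × (inv! a * inv∏! k)     ≈⟨ ×-assocˡ _ (a !) (∏! k) ⟨
      (a !) × (∏! k × (inv! a * inv∏! k))       ≈⟨ ×-congʳ (a !) (×-comm-* (∏! k) _ _) ⟨
      (a !) × (inv! a * (∏! k × inv∏! k))       ≈⟨ ×-assoc-* (a !) _ _ ⟨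
      ((a !) × inv! a) * (∏! k × inv∏! k)       ≈⟨ *-cong (×-inv! a) (×-inv∏! k) ⟩
      1# * 1#                                   ≈⟨ *-identityˡ 1# ⟩
      1#                                        ∎

    -- After multiplication by n!·(n + 1) = (n + 1)! the prefactor is a bare sign. The tuple sum
    -- supplies n! times the coefficient, so n! cancels.
    transform-coefficient : ∀ r → let n = suc r in
      suc n × transform γ n ≈ ε ^ suc n * (geometric ^ˢ suc n) n
    transform-coefficient r = ×-cancel (n !) {{n ℕₚ.!≢0}} (begin
      (n !) × (suc n × (σ * Σ))                      ≈⟨ ×-assocˡ _ (n !) (suc n) ⟩
      ((n !) ℕ.* suc n) × (σ * Σ)                    ≡⟨ ≡.cong (_× (σ * Σ)) (ℕₚ.*-comm (n !) (suc n)) ⟩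
      (suc n !) × (σ * Σ)                            ≈⟨ ×-assoc-* (suc n !) σ Σ ⟨
      ((suc n !) × σ) * Σ
        ≈⟨ *-cong (trans (×-/ (-1ℤ ℤ.^ suc n) (suc n !) {{suc n ℕₚ.!≢0}}) (sign (suc n))) Σ≈ ⟩
      ε ^ suc n * ((n !) × (geometric ^ˢ suc n) n)  ≈⟨ ×-comm-* (n !) _ _ ⟩
      (n !) × (ε ^ suc n * (geometric ^ˢ suc n) n)  ∎)
      where
      n : ℕ
      n = suc r
      σ Σ : ℂ
      σ = fromℚ (((-1ℤ ℤ.^ suc n) ℚ./ (suc n !)) {{suc n ℕₚ.!≢0}})
      coefficient : Vec ℕ n → ℂ
      coefficient k = fromℚ ((ℤ.+ ((Vec.sum k ℕ.+ n) !) ℚ./ ∏! k) {{∏!≢0 k}})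
      Σ = ∑ (tuples n) (λ k → coefficient k * monomial γ k)
      coefficient≈ : ∀ k → coefficient k ≈ (((Vec.sum k ℕ.+ n) !) × 1#) * inv∏! k
      coefficient≈ k = ×-cancel (∏! k) {{∏!≢0 k}} (begin
        ∏! k × coefficient k               ≈⟨ ×-/ (ℤ.+ x) (∏! k) {{∏!≢0 k}} ⟩
        fromℤ (ℤ.+ x)                      ≈⟨ fromℕ≈× x ⟩
        x × 1#                             ≈⟨ *-identityʳ _ ⟨
        (x × 1#) * 1#                      ≈⟨ *-congˡ (×-inv∏! k) ⟨
        (x × 1#) * (∏! k × inv∏! k)        ≈⟨ ×-comm-* (∏! k) _ _ ⟩
        ∏! k × ((x × 1#) * inv∏! k)        ∎)
        where
        x : ℕ
        x = (Vec.sum k ℕ.+ n) !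
      Σ≈ : Σ ≈ (n !) × (geometric ^ˢ suc n) n
      Σ≈ = ExplicitSum.sumL-tuples ℂ-commutativeRing (λ m → ×-cancel (suc m)) inv! inv!-laws
        (dropConstant γ) geometric refl geometric-fix r coefficient coefficient≈

  -- `transform-coefficient` turns the hypothesis into the relation that `involution` reverses and
  -- turns the result back; the factor n + 1 is then cancelled.
  transform-inverse : ∀ α β → (∀ n → n ≥ 1 → α n ≈ transform β n) → ∀ n → n ≥ 1 → β n ≈ transform α n
  transform-inverse α β α≈Tβ (suc r) _ = ×-cancel (suc (suc r)) (trans
    (Involution.involution ℂ-commutativeRing (λ m → ×-cancel (suc m))
      (dropConstant β) (geometric β) (dropConstant α) (geometric α) refl refl (geometric-fix β) (geometric-fix α)
      (λ m → trans (×-congʳ (suc (suc m)) (α≈Tβ (suc m) (ℕ.s≤s ℕ.z≤n))) (transform-coefficient β m)) r)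
    (sym (transform-coefficient α r)))

theorem4p3 : (α β : ℕ → ℂ) →
    (∀ n → n ≥ 1 → α n ≈ transform β n) ⇔ (∀ n → n ≥ 1 → β n ≈ transform α n)
theorem4p3 α β = mk⇔ (transform-inverse α β) (transform-inverse β α)
  where
  open ℂ-Arithmetic
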